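{- Let $w\in S_n$ have length $\ell$. In the algebra $\mathcal{K}_+$ the following holds: $$\mathfrak{S}_w(u_1,u_2-u_1,u_3-u_2,\dots)=\frac{1}{[\ell]_q!}\sum_{\mathbf{a}=a_1\cdots a_\ell\in \mathrm{Red}(w)} q^{\mathrm{comaj}(\mathbf{a})}\,u_{a_1}u_{a_2}\cdots u_{a_\ell},$$ where the left side means the Schubert polynomial $\mathfrak{S}_w(x_1,x_2,\dots)$ evaluated at $x_1=u_1$ and $x_i=u_i-u_{i-1}$ for $i>1$.
   Context: $\mathbf{k}$ is a field of characteristic zero and $q\in\mathbf{k}$ is not a nontrivial root of unity; $[n]_q=1+q+\dots+q^{n-1}$, $[n]_q!=\prod_{i=1}^n[i]_q$. $\mathcal{K}_+$ is the commutative $\mathbf{k}$-algebra generated by $u_1,u_2,\dots$ subject to $(q+1)u_i^2=qu_iu_{i-1}+u_iu_{i+1}$ for all $i\ge1$, with the convention $u_0=0$. Schubert polynomials: for $w_0$ the longest element of $S_n$, $\mathfrak{S}_{w_0}=x_1^{n-1}x_2^{n-2}\cdots x_{n-1}$, and $\mathfrak{S}_{ws_i}=\partial_i\mathfrak{S}_w$ whenever $w(i)>w(i+1)$, where $\partial_i f=(f-s_if)/(x_i-x_{i+1})$ and $s_i$ swaps $x_i,x_{i+1}$. $\mathrm{Red}(w)$ is the set of reduced words $a_1\cdots a_\ell$ of $w$ (i.e. $w=s_{a_1}\cdots s_{a_\ell}$ with $\ell=\ell(w)$), and $\mathrm{comaj}(\mathbf{a})$ is the sum of all $i\in\{1,\dots,\ell-1\}$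 with $a_i<a_{i+1}$. -}

module Defs where

open import Level using (Level; _⊔_) renaming (suc to lsuc)
open import Data.Nat using (ℕ; zero; suc; _∸_; _⊓_; _≡ᵇ_; _<ᵇ_)
import Data.Nat as ℕ
open import Data.Integer as ℤ using (ℤ; +_; -[1+_])
open import Data.Bool using (Bool; true; false; if_then_else_; _∧_)
open import Data.Maybe using (Maybe; just; nothing)
open import Data.List using (List; []; _∷_; map; foldr; length; concatMap; upTo; allFin; filterᵇ)
open import Data.Product using (_×_; _,_)
open import Data.Fin using (Fin; toℕ)
open import Data.Fin.Permutation using (Permutation′; _⟨$⟩ʳ_)
open import Algebra.Bundles using (CommutativeRing)
open import Algebra.Morphism.Structures using (IsRingHomomorphism)
open import Relation.Nullary using (¬_)

module RingOps {c ℓ} (R : CommutativeRing c ℓ) where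
  open CommutativeRing R

  pow : Carrier → ℕ → Carrier
  pow x zero    = 1#
  pow x (suc n) = x * pow x n

  natCast : ℕ → Carrier
  natCast zero    = 0#
  natCast (suc n) = 1# + natCast n

  intCast : ℤ → Carrier
  intCast (+ n)    = natCast n
  intCast -[1+ n ] = - natCast (suc n)

  sumL : List Carrier → Carrier
  sumL = foldr _+_ 0#

  prodL : List Carrier → Carrier
  prodL = foldr _*_ 1#

  qInt : Carrier → ℕ → Carrier
  qInt q n = sumL (map (pow q) (upTo n))

  qFact : Carrier → ℕ → Carrier
  qFact q n = prodL (map (λ i → qInt q (suc i)) (upTo n))

-- Fields (a commutative ring with 0 ≠ 1 in which nonzero elements are
-- invertible; _⁻¹ is total, its value at 0 is irrelevant)

record Field (c ℓ : Level) : Set (lsuc (c ⊔ ℓ)) where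
  field
    commutativeRing : CommutativeRing c ℓ
  open CommutativeRing commutativeRing public
  field
    _⁻¹        : Carrier → Carrier
    ⁻¹-inverse : ∀ x → ¬ (x ≈ 0#) → x * (x ⁻¹) ≈ 1#
    0≉1        : ¬ (0# ≈ 1#)

module _ {c ℓ} (K : Field c ℓ) where
  open Field K
  open RingOps commutativeRing

  CharacteristicZero : Set ℓ
  CharacteristicZero = ∀ n → ¬ (natCast (suc n) ≈ 0#)

  NotNontrivialRootOfUnity : Carrier → Set ℓ
  NotNontrivialRootOfUnity q = ∀ m → pow q (suc m) ≈ 1# → q ≈ 1#

  IsAlgebraMap : ∀ {a ℓ'} (A : CommutativeRing a ℓ') →
                 (Carrier → CommutativeRing.Carrier A) → Set (c ⊔ ℓ ⊔ ℓ')
  IsAlgebraMap A ι = IsRingHomomorphism (CommutativeRing.rawRing commutativeRing)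
                                        (CommutativeRing.rawRing A) ι

-- The relations of 𝒦₊ in a commutative algebra A, for a family
-- u : ℕ → A (only u 1, u 2, ... are used; u₀ enforces u_0 = 0)

module _ {a ℓ'} (A : CommutativeRing a ℓ') where
  open CommutativeRing A

  u₀ : (ℕ → Carrier) → ℕ → Carrier
  u₀ u zero    = 0#
  u₀ u (suc i) = u (suc i)

  K₊Relations : Carrier → (ℕ → Carrier) → Set ℓ'
  K₊Relations qA u = ∀ i →
    (qA + 1#) * (u₀ u (suc i) * u₀ u (suc i))
      ≈ qA * (u₀ u (suc i) * u₀ u i) + u₀ u (suc i) * u₀ u (suc (suc i))

  xSubst : (ℕ → Carrier) → ℕ → Carrier
  xSubst u i = u₀ u i - u₀ u (i ∸ 1)

-- Polynomials in x_1, x_2, ... with integer coefficients, as lists of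
-- terms (coefficient, exponent list); position k of an exponent list is
-- the exponent of x_(k+1).  Repeated monomials are allowed.

Monomial : Set
Monomial = List ℕ

Poly : Set
Poly = List (ℤ × Monomial)

expAt : Monomial → ℕ → ℕ
expAt []       _       = 0
expAt (e ∷ _)  zero    = e
expAt (_ ∷ es) (suc k) = expAt es k

setAt : Monomial → ℕ → ℕ → Monomial
setAt []       zero    v = v ∷ []
setAt []       (suc k) v = 0 ∷ setAt [] k v
setAt (_ ∷ es) zero    v = v ∷ es
setAt (e ∷ es) (suc k) v = e ∷ setAt es k v

-- Divided difference ∂_i (i ≥ 1) on a single term c·x^e, computed by the
-- exact quotient (f - s_i f)/(x_i - x_{i+1}): with p, r the exponents of
-- x_i, x_{i+1}, m = min p r, d = |p - r|,
--   ∂_i (x_i^p x_{i+1}^r) = ± Σ_{j<d} x_i^(m+j) x_{i+1}^(m+d-1-j)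
-- (sign + if p > r, - if p < r; zero if p = r).
∂term : ℕ → ℤ × Monomial → Poly
∂term i (c , e) =
  map (λ j → sgn , setAt (setAt e (i ∸ 1) (m ℕ.+ j)) i (m ℕ.+ (d ∸ 1 ∸ j))) (upTo d)
  where
    p = expAt e (i ∸ 1)
    r = expAt e i
    m = p ⊓ r
    d = (p ∸ r) ℕ.+ (r ∸ p)
    sgn = if r <ᵇ p then c else ℤ.- c

∂ : ℕ → Poly → Poly
∂ i = concatMap (∂term i)

module _ {a ℓ'} (A : CommutativeRing a ℓ') where
  open CommutativeRing A
  open RingOps A

  evalMonoFrom : (ℕ → Carrier) → ℕ → Monomial → Carrier
  evalMonoFrom v k []       = 1#
  evalMonoFrom v k (e ∷ es) = pow (v k) e * evalMonoFrom v (suc k) es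

  evalPoly : (ℕ → Carrier) → Poly → Carrier
  evalPoly v = foldr (λ { (c , e) acc → intCast c * evalMonoFrom v 1 e + acc }) 0#

oneLine : ∀ {n} → Permutation′ n → List ℕ
oneLine {n} w = map (λ i → suc (toℕ (w ⟨$⟩ʳ i))) (allFin n)

firstAscent : List ℕ → ℕ → Maybe ℕ
firstAscent (x ∷ y ∷ rest) k = if x <ᵇ y then just k else firstAscent (y ∷ rest) (suc k)
firstAscent _              _ = nothing

-- one-line notation of w s_i from that of w (swap positions i, i+1)
swapAt : ℕ → List ℕ → List ℕ
swapAt (suc zero)    (x ∷ y ∷ rest) = y ∷ x ∷ rest
swapAt (suc (suc i)) (x ∷ rest)     = x ∷ swapAt (suc i) rest
swapAt _             L              = L

inversions : List ℕ → ℕ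
inversions []       = 0
inversions (x ∷ xs) = length (filterᵇ (λ y → y <ᵇ x) xs) ℕ.+ inversions xs

len : ∀ {n} → Permutation′ n → ℕ
len w = inversions (oneLine w)

-- Schubert polynomials via the defining recursion:
--   𝔖_{w₀} = x_1^(n-1) x_2^(n-2) ... x_(n-1),
--   𝔖_{w s_i} = ∂_i 𝔖_w  whenever w(i) > w(i+1).
-- For w ≠ w₀ we take the first ascent i of w (w(i) < w(i+1)); then
-- v = w s_i has a descent at i and 𝔖_w = 𝔖_{v s_i} = ∂_i 𝔖_v.
-- The fuel n*n ≥ ℓ(w₀) bounds the number of steps (each step raises the
-- length by one), so the fuel-exhausted clause is never reached.

δ : ℕ → Monomial
δ n = map (λ k → n ∸ 1 ∸ k) (upTo n)

schubertAux : ℕ → ℕ → List ℕ → Poly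
schubertAux n fuel L = go (firstAscent L 1) fuel
  where
    go : Maybe ℕ → ℕ → Poly
    go nothing  _        = (+ 1 , δ n) ∷ []
    go (just i) zero     = []
    go (just i) (suc f)  = ∂ i (schubertAux n f (swapAt i L))

schubert : ∀ n → Permutation′ n → Poly
schubert n w = schubertAux n (n ℕ.* n) (oneLine w)

sℕ : ℕ → ℕ → ℕ
sℕ a m = if m ≡ᵇ a then suc a else (if m ≡ᵇ suc a then a else m)

actW : List ℕ → ℕ → ℕ
actW []       m = m
actW (a ∷ as) m = sℕ a (actW as m)

eqListᵇ : List ℕ → List ℕ → Bool
eqListᵇ []       []       = true
eqListᵇ (x ∷ xs) (y ∷ ys) = (x ≡ᵇ y) ∧ eqListᵇ xs ys
eqListᵇ _        _        = false

words : ℕ → ℕ → List (List ℕ)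
words n zero    = [] ∷ []
words n (suc k) = concatMap (λ a → map (a ∷_) (words n k)) (map suc (upTo (n ∸ 1)))

representsᵇ : ℕ → List ℕ → List ℕ → Bool
representsᵇ n L word = eqListᵇ (map (actW word) (map suc (upTo n))) L

Red : ∀ n → Permutation′ n → List (List ℕ)
Red n w = filterᵇ (representsᵇ n (oneLine w)) (words n (len w))

comajFrom : ℕ → List ℕ → ℕ
comajFrom k (x ∷ y ∷ rest) = (if x <ᵇ y then k else 0) ℕ.+ comajFrom (suc k) (y ∷ rest)
comajFrom k _              = 0

comaj : List ℕ → ℕ
comaj = comajFrom 1

{-# OPTIONS --safe #-}

-- In the nilCoxeter algebra, Σ_w 𝔖_w(x) e_w = A₁(x₁) A₂(x₂) ⋯ with A_i(x) = (1 + x e_{n-1}) ⋯ (1 + x e_i).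
-- Everything rests on the exchange rule A_i(z + g) A_{i+1}(b) = A_i(z) A_{i+1}(b + g) (1 + g e_i),
-- valid as soon as g z = g b.
--
-- With g = x_i - x_{i+1} and z = b = x_{i+1} it gives the divided difference recursion.  In 𝒦₊ one has
-- u_i (q x_i) = u_i x_{i+1} for x_i = u_i - u_{i-1}, so it also applies to g = (1 - q) u_i and z = q x_i,
-- and yields 𝔖(x) = 𝔖(q x) (1 + (1 - q) u_{n-1} e_{n-1}) ⋯ (1 + (1 - q) u_1 e_1).  Expanding the product
-- factor by factor counts reduced words by their last letter, with weights q^comaj.
--
-- Both uses would require dividing, by x_i - x_{i+1} and by 1 - q, which is impossible in a general
-- ring or for q = 1.  Instead one works over R[s] / (s² - δ s), where s plays the role of δ, and
-- compares coefficients of s.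
module Submission where

open import Defs
open import Level using (Level; _⊔_)
open import Data.Nat as Nat using (ℕ; zero; suc; _<ᵇ_; _≤_; _<_; _∸_; _⊓_; z≤n; s≤s)
open import Data.Nat.Properties as Natₚ using (≤-refl; ≤-trans; ≤-reflexive)
open import Data.Integer as ℤ using (ℤ; +_; -[1+_])
open import Data.Bool using (Bool; true; false; if_then_else_; T; _∧_)
open import Data.Bool.Properties using (∧-zeroʳ; ∧-assoc; ∧-comm)
open import Data.Empty using (⊥-elim)
open import Data.Maybe using (just; nothing)
open import Data.Fin.Permutation using (Permutation′; _⟨$⟩ʳ_; _⟨$⟩ˡ_; inverseˡ)
open import Data.Fin.Properties using (toℕ<n; toℕ-injective)
open import Data.List using (List; []; _∷_; _∷ʳ_; _++_; map; concatMap; upTo; allFin; applyUpTo; length; filterᵇ)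
open import Data.List.Properties
  using (map-applyUpTo; map-cong; map-∘; map-id; length-map; length-tabulate; length-filter; ∷-injective)
open import Data.List.Relation.Unary.All as All using (All; []; _∷_)
open import Data.List.Relation.Unary.AllPairs using ([]; _∷_)
open import Data.List.Relation.Unary.Unique.Propositional using (Unique)
import Data.List.Relation.Unary.All.Properties as Allₚ
import Data.List.Relation.Unary.Unique.Propositional.Properties as Uniqueₚ
open import Data.Product using (_×_; _,_; proj₁; proj₂; ∃-syntax)
open import Data.Sum using ([_,_]′)
open import Function using (_∘_; id)
open import Algebra.Bundles using (CommutativeRing; CommutativeMonoid; AbelianGroup)
open import Algebra.Structures using (IsCommutativeRing)
open import Algebra.Morphism.Structures using (IsRingHomomorphism)
import Algebra.Construct.DirectProduct as DirectProduct
import Algebra.Properties.CommutativeSemigroup as CommutativeSemigroupProperties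
import Algebra.Properties.Ring as RingProperties
import Algebra.Solver.Ring.NaturalCoefficients.Default as SemiringSolver
open import Relation.Binary.Bundles using (Setoid)
import Relation.Binary.PropositionalEquality as ≡
open ≡ using (_≡_; _≢_)
import Relation.Binary.Reasoning.Setoid as SetoidReasoning
open import Relation.Nullary using (¬_)

-- An element b + d s has the value b at s = 0 and b + δ d at s = δ, so d acts as the quotient of
-- their difference by δ, and s f(s) = f(δ) s. This explains the weak condition g z = g b: for g a
-- multiple of s it compares z and b at s = δ only. Every divided difference costs one extension of
-- the current ring, so the statements about 𝔖 are proved for all commutative rings at once. For 𝒦₊
-- one takes δ = q - 1. Then (1 + s)ˡ = 1 + [l] s, and since 𝔖 is homogeneous, [l] 𝔖 appears as an
-- s-component. The obstacle in counting words is that q^comaj depends on the last two letters, so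
-- an induction on the whole sum over reduced words does not close. What does close is the sum over
-- reduced words with last letter at most j: up to [l-1]! it is the s-component of the partial
-- product that keeps only the factors with e_i, i > j. It vanishes for j = 0 and is the whole sum
-- for j = n - 1.

-- R[s] / (s² - δ s), the pair (b , d) standing for b + d s.
module QuadraticExtension {a ℓ} (R : CommutativeRing a ℓ) (δ : CommutativeRing.Carrier R) where
  open CommutativeRing R
  open SemiringSolver commutativeSemiring
    using (solve; _:+_; _:*_; _:=_; con)

  infix  4 _≈²_
  infixl 6 _+²_
  infixl 7 _*²_

  _≈²_ : Carrier × Carrier → Carrier × Carrier → Set ℓ
  x ≈² y = (proj₁ x ≈ proj₁ y) × (proj₂ x ≈ proj₂ y)

  _+²_ _*²_ : Carrier × Carrier → Carrier × Carrier → Carrier × Carrier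
  x +² y = (proj₁ x + proj₁ y) , (proj₂ x + proj₂ y)
  x *² y = (proj₁ x * proj₁ y) , (proj₁ x * proj₂ y + proj₂ x * proj₁ y + δ * (proj₂ x * proj₂ y))

  -²_ : Carrier × Carrier → Carrier × Carrier
  -² x = (- proj₁ x) , (- proj₂ x)

  -- Kept abstract: comparing two extensions would otherwise unfold the solver's proofs.
  abstract
    isCommutativeRing² : IsCommutativeRing _≈²_ _+²_ _*²_ -²_ (0# , 0#) (1# , 0#)
    isCommutativeRing² = record
      { isRing = record
        { +-isAbelianGroup =
            AbelianGroup.isAbelianGroup (DirectProduct.abelianGroup +-abelianGroup +-abelianGroup)
        ; *-cong = λ (p , p′) (r , r′) → *-cong p r
            , +-cong (+-cong (*-cong p r′) (*-cong p′ r)) (*-congˡ (*-cong p′ r′))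
        ; *-assoc = λ (b , d) (b′ , d′) (b″ , d″) → *-assoc b b′ b″
            , solve 7 (λ δ b d b′ d′ b″ d″ →
                (b :* b′) :* d″ :+ (b :* d′ :+ d :* b′ :+ δ :* (d :* d′)) :* b″
                  :+ δ :* ((b :* d′ :+ d :* b′ :+ δ :* (d :* d′)) :* d″)
                := b :* (b′ :* d″ :+ d′ :* b″ :+ δ :* (d′ :* d″)) :+ d :* (b′ :* b″)
                  :+ δ :* (d :* (b′ :* d″ :+ d′ :* b″ :+ δ :* (d′ :* d″))))
                refl δ b d b′ d′ b″ d″
        ; *-identity = (λ (b , d) → *-identityˡ b
              , solve 3 (λ δ b d → con 1 :* d :+ con 0 :* b :+ δ :* (con 0 :* d) := d) refl δ b d)
            , (λ (b , d) → *-identityʳ b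
              , solve 3 (λ δ b d → b :* con 0 :+ d :* con 1 :+ δ :* (d :* con 0) := d) refl δ b d)
        ; distrib = (λ (b , d) (b′ , d′) (b″ , d″) → distribˡ b b′ b″
              , solve 7 (λ δ b d b′ d′ b″ d″ →
                  b :* (d′ :+ d″) :+ d :* (b′ :+ b″) :+ δ :* (d :* (d′ :+ d″))
                  := (b :* d′ :+ d :* b′ :+ δ :* (d :* d′)) :+ (b :* d″ :+ d :* b″ :+ δ :* (d :* d″)))
                  refl δ b d b′ d′ b″ d″)
            , (λ (b , d) (b′ , d′) (b″ , d″) → distribʳ b b′ b″
              , solve 7 (λ δ b d b′ d′ b″ d″ →
                  (b′ :+ b″) :* d :+ (d′ :+ d″) :* b :+ δ :* ((d′ :+ d″) :* d)
                  := (b′ :* d :+ d′ :* b :+ δ :* (d′ :* d)) :+ (b″ :* d :+ d″ :* b :+ δ :* (d″ :* d)))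
                  refl δ b d b′ d′ b″ d″)
        }
      ; *-comm = λ (b , d) (b′ , d′) → *-comm b b′
          , solve 5 (λ δ b d b′ d′ → b :* d′ :+ d :* b′ :+ δ :* (d :* d′)
                       := b′ :* d :+ d′ :* b :+ δ :* (d′ :* d)) refl δ b d b′ d′
      }

  extension : CommutativeRing a ℓ
  extension = record { isCommutativeRing = isCommutativeRing² }

-- Right multiplication in the nilCoxeter algebra and the exchange rule

<ᵇ-asym : ∀ m n → (m <ᵇ n) ≡ true → (n <ᵇ m) ≡ true → ∀ {a} {A : Set a} → A
<ᵇ-asym m n p r = ⊥-elim (Natₚ.<-asym (Natₚ.<ᵇ⇒< m n (≡.subst T (≡.sym p) _)) (Natₚ.<ᵇ⇒< n m (≡.subst T (≡.sym r) _)))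

-- A function on one-line notations is an element of the nilCoxeter algebra, given by its
-- coefficients, and operators act on it by right multiplication.
module Operators {a ℓ} (R : CommutativeRing a ℓ) where
  open CommutativeRing R
  open SemiringSolver commutativeSemiring using (solve; _:+_; _:*_; _:=_; con)

  Fun : Set a
  Fun = List ℕ → Carrier

  Op : Set a
  Op = Fun → Fun

  infix 4 _≋_
  _≋_ : Fun → Fun → Set ℓ
  f ≋ g = ∀ L → f L ≈ g L

  ≋-refl : ∀ {f} → f ≋ f
  ≋-refl L = refl

  ≋-sym : ∀ {f g} → f ≋ g → g ≋ f
  ≋-sym p L = sym (p L)

  ≋-trans : ∀ {f g k} → f ≋ g → g ≋ k → f ≋ k
  ≋-trans p r L = trans (p L) (r L)

  funSetoid : Setoid a ℓ
  funSetoid = record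
    { Carrier = Fun
    ; _≈_ = _≋_
    ; isEquivalence = record
      { refl  = λ L → refl
      ; sym   = λ p L → sym (p L)
      ; trans = λ p r L → trans (p L) (r L)
      }
    }

  -- Detects a descent: the coefficient of e_w in f e₁ is f(w s₁) if w(1) > w(2), and 0 otherwise
  -- because e_v e₁ = 0 when v s₁ is shorter than v.
  χ : ℕ → ℕ → Carrier
  χ x y = if y <ᵇ x then 1# else 0#

  -- This encodes e₁² = 0.
  χ-antisym : ∀ x y → χ x y * χ y x ≈ 0#
  χ-antisym x y with y <ᵇ x in p | x <ᵇ y in r
  ... | false | _     = zeroˡ _
  ... | true  | false = zeroʳ _
  ... | true  | true  = <ᵇ-asym y x p r

  -- Multiplication by 1 + x e₁.
  h₀ : Carrier → Op
  h₀ x f (p ∷ r ∷ t) = f (p ∷ r ∷ t) + x * (χ p r * f (r ∷ p ∷ t))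
  h₀ x f L           = f L

  -- Acting behind the first entry raises the index of every generator by one.
  shift : Op → Op
  shift F f []      = f []
  shift F f (p ∷ t) = F (f ∘ (p ∷_)) t

  -- Indices of operators start at 0: h j x multiplies by 1 + x e_{j+1}.
  h : ℕ → Carrier → Op
  h zero    x = h₀ x
  h (suc j) x = shift (h j x)

  -- (1 + x e_m) ⋯ (1 + x e₁)
  A : ℕ → Carrier → Op
  A zero    x f = f
  A (suc m) x f = h₀ x (shift (A m x) f)

  -- The Fomin-Stanley product A₁(v₀) A₂(v₁) ⋯ A_m(v_{m-1}), where A_i(x) = (1 + x e_m) ⋯ (1 + x e_i).
  S : ℕ → (ℕ → Carrier) → Op
  S zero    v f = f
  S (suc m) v f = shift (S m (v ∘ suc)) (A (suc m) (v 0) f)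

  record Linear (F : Op) : Set (a ⊔ ℓ) where
    field
      cong  : ∀ {f g} → f ≋ g → F f ≋ F g
      +-hom : ∀ f g → F (λ L → f L + g L) ≋ λ L → F f L + F g L
      *-hom : ∀ c f → F (λ L → c * f L) ≋ λ L → c * F f L
  open Linear

  id-linear : Linear id
  id-linear = record { cong = id ; +-hom = λ f g → ≋-refl ; *-hom = λ c f → ≋-refl }

  ∘-linear : ∀ {F G} → Linear F → Linear G → Linear (F ∘ G)
  ∘-linear lF lG = record
    { cong  = cong lF ∘ cong lG
    ; +-hom = λ f g → ≋-trans (cong lF (+-hom lG f g)) (+-hom lF _ _)
    ; *-hom = λ c f → ≋-trans (cong lF (*-hom lG c f)) (*-hom lF _ _)
    }

  shift-linear : ∀ {F} → Linear F → Linear (shift F)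
  shift-linear lF = record
    { cong  = λ { p [] → p [] ; p (_ ∷ t) → cong lF (λ t → p (_ ∷ t)) t }
    ; +-hom = λ { f g [] → refl ; f g (_ ∷ t) → +-hom lF _ _ t }
    ; *-hom = λ { c f [] → refl ; c f (_ ∷ t) → *-hom lF _ _ t }
    }

  h₀-linear : ∀ x → Linear (h₀ x)
  h₀-linear x = record
    { cong  = λ { p [] → p [] ; p (_ ∷ []) → p _
                ; p (_ ∷ _ ∷ _) → +-cong (p _) (*-congˡ (*-congˡ (p _))) }
    ; +-hom = λ { f g [] → refl ; f g (_ ∷ []) → refl
                ; f g (_ ∷ _ ∷ _) → solve 6 (λ x c a b a′ b′ →
                    (a :+ b) :+ x :* (c :* (a′ :+ b′))
                    := (a :+ x :* (c :* a′)) :+ (b :+ x :* (c :* b′))) refl _ _ _ _ _ _ }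
    ; *-hom = λ { c f [] → refl ; c f (_ ∷ []) → refl
                ; c f (_ ∷ _ ∷ _) → solve 5 (λ x k c a b →
                    c :* a :+ x :* (k :* (c :* b)) := c :* (a :+ x :* (k :* b))) refl _ _ _ _ _ }
    }

  h-linear : ∀ j x → Linear (h j x)
  h-linear zero    x = h₀-linear x
  h-linear (suc j) x = shift-linear (h-linear j x)

  A-linear : ∀ m x → Linear (A m x)
  A-linear zero    x = id-linear
  A-linear (suc m) x = ∘-linear (h₀-linear x) (shift-linear (A-linear m x))

  S-linear : ∀ m v → Linear (S m v)
  S-linear zero    v = id-linear
  S-linear (suc m) v = ∘-linear (shift-linear (S-linear m (v ∘ suc))) (A-linear (suc m) (v 0))

  shift-cong : ∀ {F G} → (∀ f → F f ≋ G f) → ∀ f → shift F f ≋ shift G f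
  shift-cong p f []      = refl
  shift-cong p f (_ ∷ t) = p _ t

  shift-∘ : ∀ F G f → shift F (shift G f) ≋ shift (F ∘ G) f
  shift-∘ F G f []      = refl
  shift-∘ F G f (_ ∷ _) = refl

  h₀-congˣ : ∀ {x y} → x ≈ y → ∀ f → h₀ x f ≋ h₀ y f
  h₀-congˣ p f []          = refl
  h₀-congˣ p f (_ ∷ [])    = refl
  h₀-congˣ p f (_ ∷ _ ∷ _) = +-congˡ (*-congʳ p)

  A-congˣ : ∀ m {x y} → x ≈ y → ∀ f → A m x f ≋ A m y f
  A-congˣ zero    p f = ≋-refl
  A-congˣ (suc m) p f = ≋-trans (cong (h₀-linear _) (shift-cong (A-congˣ m p) f)) (h₀-congˣ p _)

  S-congˣ : ∀ m {v w} → (∀ k → v k ≈ w k) → ∀ f → S m v f ≋ S m w f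
  S-congˣ zero    p f = ≋-refl
  S-congˣ (suc m) {v} p f = ≋-trans (cong (shift-linear (S-linear m (v ∘ suc))) (A-congˣ (suc m) (p 0) f))
                              (shift-cong (S-congˣ m (p ∘ suc)) _)

  -- Two shifts leave only e₃, e₄, ..., which commute with e₁. Linearity of `F` is what makes it
  -- pass through the combination formed by `h₀`.
  shift²-h₀ : ∀ {F} → Linear F → ∀ x f → shift (shift F) (h₀ x f) ≋ h₀ x (shift (shift F) f)
  shift²-h₀ lF x f []          = refl
  shift²-h₀ lF x f (_ ∷ [])    = refl
  shift²-h₀ lF x f (p ∷ r ∷ t) = trans (+-hom lF _ _ t)
    (+-congˡ (trans (*-hom lF _ _ t) (*-congˡ (*-hom lF _ _ t))))

  -- (1 + z e₁)(1 + g e₁) has no quadratic term, since e₁² = 0.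
  h₀-+ : ∀ z g f → h₀ (z + g) f ≋ h₀ g (h₀ z f)
  h₀-+ z g f []          = refl
  h₀-+ z g f (_ ∷ [])    = refl
  h₀-+ z g f (p ∷ r ∷ t) = begin
    f₁ + (z + g) * (χ p r * f₂)
      -- A summand with coefficient 0 is inserted, to be turned into the quadratic term by
      -- `χ-antisym`.
      ≈⟨ solve 5 (λ z g c f₁ f₂ → f₁ :+ (z :+ g) :* (c :* f₂)
           := (f₁ :+ z :* (c :* f₂)) :+ g :* (c :* f₂) :+ con 0 :* (g :* (z :* f₁))) refl z g (χ p r) f₁ f₂ ⟩
    (f₁ + z * (χ p r * f₂)) + g * (χ p r * f₂) + 0# * (g * (z * f₁))
      ≈⟨ +-congˡ (*-congʳ (χ-antisym p r)) ⟨
    (f₁ + z * (χ p r * f₂)) + g * (χ p r * f₂) + (χ p r * χ r p) * (g * (z * f₁))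
      ≈⟨ solve 6 (λ z g c c′ f₁ f₂ → (f₁ :+ z :* (c :* f₂)) :+ g :* (c :* f₂) :+ (c :* c′) :* (g :* (z :* f₁))
           := (f₁ :+ z :* (c :* f₂)) :+ g :* (c :* (f₂ :+ z :* (c′ :* f₁)))) refl z g (χ p r) (χ r p) f₁ f₂ ⟩
    (f₁ + z * (χ p r * f₂)) + g * (χ p r * (f₂ + z * (χ r p * f₁))) ∎
    where
      open SetoidReasoning setoid
      f₁ = f (p ∷ r ∷ t)
      f₂ = f (r ∷ p ∷ t)

  h₁ : Carrier → Op
  h₁ x = shift (h₀ x)

  -- For g = x - y and z = b = y this is the Yang-Baxter equation; only g (z - b) = 0 is needed,
  -- which is what the relations of 𝒦₊ provide.
  yang-baxter : ∀ {z g b} → g * z ≈ g * b → ∀ f →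
                h₁ b (h₀ (z + g) (h₁ g f)) ≋ h₀ g (h₁ (b + g) (h₀ z f))
  yang-baxter     e f []       = refl
  yang-baxter     e f (_ ∷ []) = refl
  yang-baxter     e f (p ∷ r ∷ []) = h₀-+ _ _ f (p ∷ r ∷ [])
  yang-baxter {z} {g} {b} e f (p ∷ q ∷ r ∷ t) = begin
    _ ≈⟨ solve 13 (λ z g b pq pr qr rq f₁ f₂ f₃ f₄ f₅ f₆ →
           ((f₁ :+ g :* (qr :* f₃)) :+ (z :+ g) :* (pq :* (f₂ :+ g :* (pr :* f₄))))
             :+ b :* (qr :* ((f₃ :+ g :* (rq :* f₁)) :+ (z :+ g) :* (pr :* (f₅ :+ g :* (pq :* f₆)))))
           := (f₁ :+ (b :+ g) :* (qr :* f₃) :+ (z :+ g) :* (pq :* f₂)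
                :+ g :* g :* (pq :* (pr :* f₄)) :+ b :* z :* (qr :* (pr :* f₅)))
             :+ ((g :* z) :* (pq :* (pr :* f₄)) :+ (g :* b) :* (qr :* (pr :* f₅))
               :+ b :* (g :* z) :* (pq :* (pr :* (qr :* f₆))) :+ g :* (g :* b) :* (pq :* (pr :* (qr :* f₆))))
             :+ (qr :* rq) :* (b :* g :* f₁))
           refl z g b (χ p q) (χ p r) (χ q r) (χ r q) f₁ f₂ f₃ f₄ f₅ f₆ ⟩
    -- `Z` is common to both sides. In the bracket the sides differ only by `g * z` against `g * b`,
    -- and the last summand vanishes on each side, by e₂² = 0 and e₁² = 0 respectively.
    Z + (g * z * w₄ + g * b * w₅ + b * (g * z) * w₆ + g * (g * b) * w₆) + (χ q r * χ r q) * (b * g * f₁)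
      ≈⟨ +-cong (+-congˡ (+-cong (+-congʳ (+-cong (*-congʳ e) (*-congʳ (sym e))))
                   (*-congʳ (*-congˡ (sym e)))))
           (trans (*-congʳ (χ-antisym q r)) (trans (zeroˡ _)
             (sym (trans (*-congʳ (χ-antisym p q)) (zeroˡ _))))) ⟩
    Z + (g * b * w₄ + g * z * w₅ + b * (g * z) * w₆ + g * (g * z) * w₆) + (χ p q * χ q p) * (z * g * f₁)
      ≈⟨ solve 13 (λ z g b pq pr qr qp f₁ f₂ f₃ f₄ f₅ f₆ →
           ((f₁ :+ z :* (pq :* f₂)) :+ (b :+ g) :* (qr :* (f₃ :+ z :* (pr :* f₅))))
             :+ g :* (pq :* ((f₂ :+ z :* (qp :* f₁)) :+ (b :+ g) :* (pr :* (f₄ :+ z :* (qr :* f₆)))))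
           := (f₁ :+ (b :+ g) :* (qr :* f₃) :+ (z :+ g) :* (pq :* f₂)
                :+ g :* g :* (pq :* (pr :* f₄)) :+ b :* z :* (qr :* (pr :* f₅)))
             :+ ((g :* b) :* (pq :* (pr :* f₄)) :+ (g :* z) :* (qr :* (pr :* f₅))
               :+ b :* (g :* z) :* (pq :* (pr :* (qr :* f₆))) :+ g :* (g :* z) :* (pq :* (pr :* (qr :* f₆))))
             :+ (pq :* qp) :* (z :* g :* f₁))
           refl z g b (χ p q) (χ p r) (χ q r) (χ q p) f₁ f₂ f₃ f₄ f₅ f₆ ⟨
    _ ∎
    where
      open SetoidReasoning setoid
      f₁ = f (p ∷ q ∷ r ∷ t)
      f₂ = f (q ∷ p ∷ r ∷ t)
      f₃ = f (p ∷ r ∷ q ∷ t)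
      f₄ = f (q ∷ r ∷ p ∷ t)
      f₅ = f (r ∷ p ∷ q ∷ t)
      f₆ = f (r ∷ q ∷ p ∷ t)
      w₄ = χ p q * (χ p r * f₄)
      w₅ = χ q r * (χ p r * f₅)
      w₆ = χ p q * (χ p r * (χ q r * f₆))
      Z  = f₁ + (b + g) * (χ q r * f₃) + (z + g) * (χ p q * f₂) + g * g * w₄ + b * z * w₅

  -- A₁(z + g) A₂(b) = A₁(z) A₂(b + g) (1 + g e₁)
  A-exchange : ∀ {z g b} → g * z ≈ g * b → ∀ m f →
               shift (A m b) (A (suc m) (z + g) f) ≋ h₀ g (shift (A m (b + g)) (A (suc m) z f))
  A-exchange {z} {g} {b} e zero f L = trans (shift-id (h₀ (z + g) (shift id f)) L)
    (trans (cong (h₀-linear (z + g)) (shift-id f) L) (trans (h₀-+ z g f L)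
      (cong (h₀-linear g) (λ L → sym (trans (shift-id _ L) (cong (h₀-linear z) (shift-id f) L))) L)))
    where
    shift-id : ∀ f → shift id f ≋ f
    shift-id f []      = refl
    shift-id f (_ ∷ _) = refl
  A-exchange {z} {g} {b} e (suc m) f = begin
    shift (A (suc m) b) (h₀ (z + g) (shift (A (suc m) (z + g)) f))
      ≈⟨ shift-∘ (h₀ b) (shift (A m b)) _ ⟨
    -- The factors of A₂(b) other than 1 + b e₂ commute with 1 + (z + g) e₁. The induction
    -- hypothesis then applies one index higher, and what remains is a relation among three factors
    -- in e₁ and e₂.
    h₁ b (shift (shift (A m b)) (h₀ (z + g) (shift (A (suc m) (z + g)) f)))
      ≈⟨ cong (h-linear 1 b) (shift²-h₀ (A-linear m b) (z + g) _) ⟩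
    h₁ b (h₀ (z + g) (shift (shift (A m b)) (shift (A (suc m) (z + g)) f)))
      ≈⟨ under (shift-∘ (shift (A m b)) (A (suc m) (z + g)) f) ⟩
    h₁ b (h₀ (z + g) (shift (λ f → shift (A m b) (A (suc m) (z + g) f)) f))
      ≈⟨ under (shift-cong (A-exchange e m) f) ⟩
    h₁ b (h₀ (z + g) (shift (λ f → h₀ g (shift (A m (b + g)) (A (suc m) z f))) f))
      ≈⟨ under (≋-trans (cong (h-linear 1 g) (shift-∘ _ _ f)) (shift-∘ _ _ f)) ⟨
    h₁ b (h₀ (z + g) (h₁ g X))
      ≈⟨ yang-baxter e X ⟩
    h₀ g (h₁ (b + g) (h₀ z X))
      ≈⟨ cong (h₀-linear g) (cong (h-linear 1 (b + g)) (shift²-h₀ (A-linear m (b + g)) z _)) ⟨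
    h₀ g (h₁ (b + g) (shift (shift (A m (b + g))) (A (suc (suc m)) z f)))
      ≈⟨ cong (h₀-linear g) (shift-∘ (h₀ (b + g)) (shift (A m (b + g))) _) ⟩
    h₀ g (shift (A (suc m) (b + g)) (A (suc (suc m)) z f)) ∎
    where
    open SetoidReasoning funSetoid
    X = shift (shift (A m (b + g))) (shift (A (suc m) z) f)
    under : ∀ {f f′} → f ≋ f′ → h₁ b (h₀ (z + g) f) ≋ h₁ b (h₀ (z + g) f′)
    under p = cong (h-linear 1 b) (cong (h₀-linear (z + g)) p)

  -- The exchange rule is applied to the neighbours A_{j+1} and A_{j+2}; the factor 1 + g e_{j+1}
  -- that it releases commutes with all later ones, which start at e_{j+3}. The element `g` is
  -- constrained only by equations, so that it can be a difference of variables or the adjoined `s`.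
  S-symmetry : ∀ {v w : ℕ → Carrier} {g} j m → suc j Nat.≤ m → (∀ k → k Nat.< j → v k ≈ w k) →
               v j ≈ w j + g → w (suc j) ≈ v (suc j) + g → g * w j ≈ g * v (suc j) →
               (∀ k → v (suc (suc (j Nat.+ k))) ≈ w (suc (suc (j Nat.+ k)))) →
               ∀ f → S m v f ≋ h j g (S m w f)
  S-symmetry {v} {w} {g} zero (suc m) _ _ p r e q f = go m
    where
    open SetoidReasoning funSetoid
    go : ∀ m → S (suc m) v f ≋ h₀ g (S (suc m) w f)
    go zero = begin
      shift id (A 1 (v 0) f)            ≈⟨ cong (shift-linear id-linear) (A-congˣ 1 p f) ⟩
      shift id (A 1 (w 0 + g) f)        ≈⟨ A-exchange e 0 f ⟩
      h₀ g (shift id (A 1 (w 0) f))     ∎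
    go (suc m) = begin
      shift (S (suc m) (v ∘ suc)) (A (2 Nat.+ m) (v 0) f)
        ≈⟨ shift-∘ (shift (S m v″)) (A (suc m) (v 1)) _ ⟨
      shift (shift (S m v″)) (shift (A (suc m) (v 1)) (A (2 Nat.+ m) (v 0) f))
        ≈⟨ rest (cong (shift-linear (A-linear (suc m) (v 1))) (A-congˣ (2 Nat.+ m) p f)) ⟩
      shift (shift (S m v″)) (shift (A (suc m) (v 1)) (A (2 Nat.+ m) (w 0 + g) f))
        ≈⟨ rest (A-exchange e (suc m) f) ⟩
      shift (shift (S m v″)) (h₀ g (shift (A (suc m) (v 1 + g)) (A (2 Nat.+ m) (w 0) f)))
        ≈⟨ shift²-h₀ (S-linear m v″) g _ ⟩
      h₀ g (shift (shift (S m v″)) (shift (A (suc m) (v 1 + g)) (A (2 Nat.+ m) (w 0) f)))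
        ≈⟨ cong (h₀-linear g) (rest (shift-cong (A-congˣ (suc m) (sym r)) _)) ⟩
      h₀ g (shift (shift (S m v″)) (shift (A (suc m) (w 1)) (A (2 Nat.+ m) (w 0) f)))
        ≈⟨ cong (h₀-linear g) (shift-cong (shift-cong (S-congˣ m q)) _) ⟩
      h₀ g (shift (shift (S m (w ∘ suc ∘ suc))) (shift (A (suc m) (w 1)) (A (2 Nat.+ m) (w 0) f)))
        ≈⟨ cong (h₀-linear g) (shift-∘ (shift (S m (w ∘ suc ∘ suc))) (A (suc m) (w 1)) _) ⟩
      h₀ g (S (2 Nat.+ m) w f) ∎
      where
      v″ = v ∘ suc ∘ suc
      rest : ∀ {f f′} → f ≋ f′ → shift (shift (S m v″)) f ≋ shift (shift (S m v″)) f′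
      rest = cong (shift-linear (shift-linear (S-linear m v″)))
  S-symmetry {v} {w} {g} (suc j) (suc m) (Nat.s≤s j<m) c p r e q f = begin
    shift (S m (v ∘ suc)) (A (suc m) (v 0) f)
      ≈⟨ cong (shift-linear (S-linear m (v ∘ suc))) (A-congˣ (suc m) (c 0 (Nat.s≤s Nat.z≤n)) f) ⟩
    shift (S m (v ∘ suc)) (A (suc m) (w 0) f)
      ≈⟨ shift-cong (S-symmetry j m j<m (λ k k<j → c (suc k) (Nat.s≤s k<j)) p r e q) _ ⟩
    shift (λ f → h j g (S m (w ∘ suc) f)) (A (suc m) (w 0) f)
      ≈⟨ shift-∘ (h j g) (S m (w ∘ suc)) _ ⟨
    h (suc j) g (S (suc m) w f) ∎
    where open SetoidReasoning funSetoid

  -- (1 + g_{j+d-1} e_{j+d}) ⋯ (1 + g_j e_{j+1})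
  H : (ℕ → Carrier) → ℕ → ℕ → Op
  H g j zero    f = f
  H g j (suc d) f = h j (g j) (H g (suc j) d f)

  shift-H : ∀ g j d f → shift (H (g ∘ suc) j d) f ≋ H g (suc j) d f
  shift-H g j zero f []      = refl
  shift-H g j zero f (_ ∷ _) = refl
  shift-H g j (suc d) f = ≋-trans (≋-sym (shift-∘ (h j (g (suc j))) (H (g ∘ suc) (suc j) d) f))
    (cong (h-linear (suc j) (g (suc j))) (shift-H g (suc j) d f))

  -- Passing y past each factor in turn: the argument carried to position k is always z k + g k.
  S-factor : ∀ {x z g : ℕ → Carrier} m y → y ≈ z 0 + g 0 →
             (∀ k → x (suc k) + g k ≈ z (suc k) + g (suc k)) →
             (∀ k → g k * z k ≈ g k * x (suc k)) → ∀ f →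
             shift (S m (x ∘ suc)) (A (suc m) y f) ≋ H g 0 (suc m) (S (suc m) z f)
  S-factor {x} {z} {g} zero y p r e f = begin
    shift id (A 1 y f)               ≈⟨ cong (shift-linear id-linear) (A-congˣ 1 p f) ⟩
    shift id (A 1 (z 0 + g 0) f)     ≈⟨ A-exchange (e 0) 0 f ⟩
    h₀ (g 0) (shift id (A 1 (z 0) f)) ∎
    where open SetoidReasoning funSetoid
  S-factor {x} {z} {g} (suc m) y p r e f = begin
    shift (S (suc m) (x ∘ suc)) (A (2 Nat.+ m) y f)
      ≈⟨ shift-∘ (shift (S m x″)) (A (suc m) (x 1)) _ ⟨
    shift (shift (S m x″)) (shift (A (suc m) (x 1)) (A (2 Nat.+ m) y f))
      ≈⟨ rest (≋-trans (cong (shift-linear (A-linear (suc m) (x 1))) (A-congˣ (2 Nat.+ m) p f))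
           (A-exchange (e 0) (suc m) f)) ⟩
    shift (shift (S m x″)) (h₀ (g 0) (shift (A (suc m) (x 1 + g 0)) (A (2 Nat.+ m) (z 0) f)))
      ≈⟨ shift²-h₀ (S-linear m x″) (g 0) _ ⟩
    h₀ (g 0) (shift (shift (S m x″)) (shift (A (suc m) (x 1 + g 0)) (A (2 Nat.+ m) (z 0) f)))
      ≈⟨ cong (h₀-linear (g 0)) (≋-trans (shift-∘ _ _ _)
           (shift-cong (S-factor {x ∘ suc} {z ∘ suc} {g ∘ suc} m _ (r 0) (r ∘ suc) (e ∘ suc)) _)) ⟩
    h₀ (g 0) (shift (λ f → H (g ∘ suc) 0 (suc m) (S (suc m) (z ∘ suc) f)) (A (2 Nat.+ m) (z 0) f))
      ≈⟨ cong (h₀-linear (g 0)) (≋-trans (≋-sym (shift-∘ _ _ _)) (shift-H g 0 (suc m) _)) ⟩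
    H g 0 (2 Nat.+ m) (S (2 Nat.+ m) z f) ∎
    where
    open SetoidReasoning funSetoid
    x″ = x ∘ suc ∘ suc
    rest : ∀ {f f′} → f ≋ f′ → shift (shift (S m x″)) f ≋ shift (shift (S m x″)) f′
    rest = cong (shift-linear (shift-linear (S-linear m x″)))

-- Descents and inversions under adjacent swaps

-- Positions are counted from 0 here but from 1 in swapAt.
desc : ℕ → List ℕ → Bool
desc zero    (p ∷ r ∷ t) = r <ᵇ p
desc (suc j) (_ ∷ t)     = desc j t
desc _       _           = false

below : ℕ → List ℕ → ℕ
below p t = length (filterᵇ (_<ᵇ p) t)

desc-swapAt : ∀ j L → desc j L ≡ true → desc j (swapAt (suc j) L) ≡ false
desc-swapAt zero (p ∷ r ∷ t) d with p <ᵇ r in e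
... | false = ≡.refl
... | true  = <ᵇ-asym r p d e
desc-swapAt (suc j) (_ ∷ t) d = desc-swapAt j t d

swapAt-involutive : ∀ j L → swapAt (suc j) (swapAt (suc j) L) ≡ L
swapAt-involutive zero    []          = ≡.refl
swapAt-involutive zero    (_ ∷ [])    = ≡.refl
swapAt-involutive zero    (_ ∷ _ ∷ _) = ≡.refl
swapAt-involutive (suc j) []          = ≡.refl
swapAt-involutive (suc j) (p ∷ t)     = ≡.cong (p ∷_) (swapAt-involutive j t)

below-∷ : ∀ p r t → below p (r ∷ t) ≡ (if r <ᵇ p then 1 else 0) Nat.+ below p t
below-∷ p r t with r <ᵇ p
... | true  = ≡.refl
... | false = ≡.refl

below-swapAt : ∀ x j L → below x (swapAt (suc j) L) ≡ below x L
below-swapAt x zero    []          = ≡.refl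
below-swapAt x zero    (_ ∷ [])    = ≡.refl
below-swapAt x zero    (p ∷ r ∷ t)
  rewrite below-∷ x p (r ∷ t) | below-∷ x r (p ∷ t) | below-∷ x r t | below-∷ x p t =
  CommutativeSemigroupProperties.x∙yz≈y∙xz Natₚ.+-commutativeSemigroup
    (if r <ᵇ x then 1 else 0) (if p <ᵇ x then 1 else 0) (below x t)
below-swapAt x (suc j) []          = ≡.refl
below-swapAt x (suc j) (p ∷ t)
  rewrite below-∷ x p (swapAt (suc j) t) | below-∷ x p t = ≡.cong (_ Nat.+_) (below-swapAt x j t)

inversions-∷∷ : ∀ p r t → inversions (p ∷ r ∷ t)
              ≡ (if r <ᵇ p then 1 else 0) Nat.+ (below p t Nat.+ below r t Nat.+ inversions t)
inversions-∷∷ p r t rewrite below-∷ p r t =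
  ≡.trans (Natₚ.+-assoc (if r <ᵇ p then 1 else 0) (below p t) _)
    (≡.cong ((if r <ᵇ p then 1 else 0) Nat.+_) (≡.sym (Natₚ.+-assoc (below p t) (below r t) (inversions t))))

inversions-descent : ∀ j L → desc j L ≡ true → inversions L ≡ suc (inversions (swapAt (suc j) L))
inversions-descent zero (p ∷ r ∷ t) d with desc-swapAt zero (p ∷ r ∷ t) d
... | d′ rewrite inversions-∷∷ p r t | inversions-∷∷ r p t | d | d′ | Natₚ.+-comm (below p t) (below r t) = ≡.refl
inversions-descent (suc j) (p ∷ t) d rewrite below-swapAt p j t | inversions-descent j t d = Natₚ.+-suc _ _

-- The inequality is not strict: equal entries, or an index past the end, leave the list as it is.
inversions-nondescent : ∀ j L → desc j L ≡ false → inversions L ≤ inversions (swapAt (suc j) L)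
inversions-nondescent zero []       d = z≤n
inversions-nondescent zero (_ ∷ []) d = z≤n
inversions-nondescent zero (p ∷ r ∷ t) d
  rewrite inversions-∷∷ p r t | inversions-∷∷ r p t | d | Natₚ.+-comm (below p t) (below r t) =
  Natₚ.m≤n+m _ (if p <ᵇ r then 1 else 0)
inversions-nondescent (suc j) [] d = z≤n
inversions-nondescent (suc j) (p ∷ t) d rewrite below-swapAt p j t =
  Natₚ.+-monoʳ-≤ (below p t) (inversions-nondescent j t d)

inversions≡0⇒nondescent : ∀ j L → inversions L ≡ 0 → desc j L ≡ false
inversions≡0⇒nondescent j L z with desc j L in d
... | false = ≡.refl
... | true with ≡.trans (≡.sym z) (inversions-descent j L d)
... | ()

range : ℕ → ℕ → List ℕ
range k zero    = []
range k (suc m) = k ∷ range (suc k) m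

-- One-line notation of w₀, as `range 1 n` is that of the identity.
down : ℕ → List ℕ
down zero    = []
down (suc m) = suc m ∷ down m

δ-suc : ∀ m → δ (2 Nat.+ m) ≡ suc m ∷ δ (suc m)
δ-suc m = ≡.cong (suc m ∷_) (≡.trans (map-applyUpTo suc _ (suc m)) (≡.sym (map-applyUpTo id _ (suc m))))

-- The property of `inversions` on which rescaling by length rests. It is abstracted because behind
-- a fixed first entry p the grading becomes κ ∘ (p ∷_), which is graded but differs from
-- `inversions`.
Graded : (List ℕ → ℕ) → Set
Graded κ = ∀ j L → desc j L ≡ true → κ L ≡ suc (κ (swapAt (suc j) L))

+-≢ : ∀ k m → (k Nat.≡ᵇ k Nat.+ suc m) ≡ false
+-≢ zero    m = ≡.refl
+-≢ (suc k) m = +-≢ k m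

≡ᵇ-refl : ∀ k → (k Nat.≡ᵇ k) ≡ true
≡ᵇ-refl zero    = ≡.refl
≡ᵇ-refl (suc k) = ≡ᵇ-refl k

<ᵇ-+ : ∀ k m → (k <ᵇ k Nat.+ suc m) ≡ true
<ᵇ-+ zero    m = ≡.refl
<ᵇ-+ (suc k) m = <ᵇ-+ k m

-- Coefficients at the identity and at the longest element

module OperatorValues {a ℓ} (R : CommutativeRing a ℓ) where
  open CommutativeRing R
  open RingOps R
  open Operators R
  open Linear
  open SetoidReasoning setoid

  h-descent : ∀ j {x f} L → desc j L ≡ true → h j x f L ≈ f L + x * f (swapAt (suc j) L)
  h-descent zero (p ∷ r ∷ t) d rewrite d = +-congˡ (*-congˡ (*-identityˡ _))
  h-descent (suc j) (_ ∷ t) d = h-descent j t d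

  h-nondescent : ∀ j {x f} L → desc j L ≡ false → h j x f L ≈ f L
  h-nondescent zero [] d = refl
  h-nondescent zero (_ ∷ []) d = refl
  h-nondescent zero (p ∷ r ∷ t) d rewrite d =
    trans (+-congˡ (trans (*-congˡ (zeroˡ _)) (zeroʳ _))) (+-identityʳ _)
  h-nondescent (suc j) [] d = refl
  h-nondescent (suc j) (_ ∷ t) d = h-nondescent j t d

  A-0 : ∀ m x f L → inversions L ≡ 0 → A m x f L ≈ f L
  A-0 zero x f L z = refl
  A-0 (suc m) x f L z = trans (h-nondescent 0 L (inversions≡0⇒nondescent 0 L z)) (go L z)
    where
    go : ∀ L → inversions L ≡ 0 → shift (A m x) f L ≈ f L
    go []      z = refl
    go (p ∷ t) z = A-0 m x (f ∘ (p ∷_)) t (Natₚ.m+n≡0⇒n≡0 (below p t) z)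

  S-0 : ∀ m v f L → inversions L ≡ 0 → S m v f L ≈ f L
  S-0 zero v f L z = refl
  S-0 (suc m) v f [] z = A-0 (suc m) (v 0) f [] z
  S-0 (suc m) v f (p ∷ t) z =
    trans (S-0 m (v ∘ suc) _ t (Natₚ.m+n≡0⇒n≡0 (below p t) z)) (A-0 (suc m) (v 0) f (p ∷ t) z)

  H-0 : ∀ g j d f L → inversions L ≡ 0 → H g j d f L ≈ f L
  H-0 g j zero f L z = refl
  H-0 g j (suc d) f L z =
    trans (h-nondescent j L (inversions≡0⇒nondescent j L z)) (H-0 g (suc j) d f L z)

  -- For k = 1 this is the unit of the nilCoxeter algebra. The start k is free because removing the
  -- first entry of a range raises it.
  ind : ℕ → ℕ → Fun
  ind k m L = if eqListᵇ (range k m) L then 1# else 0#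

  linear-0 : ∀ {F f} → Linear F → (∀ L → f L ≈ 0#) → ∀ L → F f L ≈ 0#
  linear-0 lF p L = trans (cong lF (λ L → trans (p L) (sym (zeroˡ 0#))) L)
    (trans (*-hom lF 0# (λ _ → 0#) L) (zeroˡ _))

  ind-≢ : ∀ k m z → (k Nat.≡ᵇ z) ≡ false → ∀ L → ind k (suc m) (z ∷ L) ≈ 0#
  ind-≢ k m z e L rewrite e = refl

  -- Only the word e_m ⋯ e₁ moves the maximal entry to the front.
  A-longest : ∀ m x k t → A m x (ind k (suc m)) (k Nat.+ m ∷ t) ≈ pow x m * ind k m t
  A-longest zero x k t rewrite Natₚ.+-identityʳ k | ≡ᵇ-refl k = sym (*-identityˡ _)
  A-longest (suc m) x k [] = trans
    (linear-0 (A-linear m x) (ind-≢ k (suc m) (k Nat.+ suc m) (+-≢ k m)) [])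
    (sym (zeroʳ _))
  A-longest (suc m) x k (y ∷ t) = begin
    A m x (ind k (2 Nat.+ m) ∘ (z ∷_)) (y ∷ t) + x * (χ z y * A m x (ind k (2 Nat.+ m) ∘ (y ∷_)) (z ∷ t))
      ≈⟨ +-congʳ (linear-0 (A-linear m x) (ind-≢ k (suc m) z (+-≢ k m)) (y ∷ t)) ⟩
    0# + x * (χ z y * A m x (ind k (2 Nat.+ m) ∘ (y ∷_)) (z ∷ t))
      ≈⟨ +-identityˡ _ ⟩
    x * (χ z y * A m x (ind k (2 Nat.+ m) ∘ (y ∷_)) (z ∷ t))
      ≈⟨ go ⟩
    pow x (suc m) * ind k (suc m) (y ∷ t) ∎
    where
    z = k Nat.+ suc m
    go : x * (χ z y * A m x (ind k (2 Nat.+ m) ∘ (y ∷_)) (z ∷ t)) ≈ pow x (suc m) * ind k (suc m) (y ∷ t)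
    go with k Nat.≡ᵇ y in e
    ... | false = begin
      x * (χ z y * A m x (λ L → 0#) (z ∷ t))
        ≈⟨ *-congˡ (*-congˡ (linear-0 (A-linear m x) (λ _ → refl) (z ∷ t))) ⟩
      x * (χ z y * 0#)   ≈⟨ *-congˡ (zeroʳ _) ⟩
      x * 0#             ≈⟨ zeroʳ _ ⟩
      0#                 ≈⟨ zeroʳ _ ⟨
      pow x (suc m) * 0# ∎
    ... | true with Natₚ.≡ᵇ⇒≡ k y (≡.subst T (≡.sym e) _)
    ... | ≡.refl rewrite <ᵇ-+ k m | Natₚ.+-suc k m = begin
      x * (1# * A m x (ind (suc k) (suc m)) (suc k Nat.+ m ∷ t))
        ≈⟨ *-congˡ (*-identityˡ _) ⟩
      x * A m x (ind (suc k) (suc m)) (suc k Nat.+ m ∷ t)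
        ≈⟨ *-congˡ (A-longest m x (suc k) t) ⟩
      x * (pow x m * ind (suc k) m t)
        ≈⟨ *-assoc _ _ _ ⟨
      pow x (suc m) * ind (suc k) m t ∎

  -- Each factor of the product must bring the largest remaining entry to the front, which costs m,
  -- m - 1, ... powers of successive variables: the staircase monomial. The offset `k` and the
  -- constant `c` record what has been used up.
  S-longest : ∀ m v k c → S m (v ∘ (k Nat.+_)) (λ L → c * ind 1 (suc m) L) (down (suc m))
            ≈ c * evalMonoFrom R v k (δ (suc m))
  S-longest zero v k c = *-congˡ (sym (*-identityˡ 1#))
  S-longest (suc m) v k c = begin
    S m (v ∘ (k Nat.+_) ∘ suc) (λ t → A (suc m) x (λ L → c * ind 1 (2 Nat.+ m) L) (2 Nat.+ m ∷ t)) (down (suc m))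
      ≈⟨ S-congˣ m (λ i → reflexive (≡.cong v (Natₚ.+-suc k i))) _ (down (suc m)) ⟩
    S m (v ∘ (suc k Nat.+_)) (λ t → A (suc m) x (λ L → c * ind 1 (2 Nat.+ m) L) (2 Nat.+ m ∷ t)) (down (suc m))
      ≈⟨ cong (S-linear m _) (λ t → begin
           A (suc m) x (λ L → c * ind 1 (2 Nat.+ m) L) (2 Nat.+ m ∷ t)
             ≈⟨ *-hom (A-linear (suc m) x) c (ind 1 (2 Nat.+ m)) (2 Nat.+ m ∷ t) ⟩
           c * A (suc m) x (ind 1 (2 Nat.+ m)) (2 Nat.+ m ∷ t)
             ≈⟨ *-congˡ (A-longest (suc m) x 1 t) ⟩
           c * (pow x (suc m) * ind 1 (suc m) t)
             ≈⟨ *-assoc _ _ _ ⟨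
           c * pow x (suc m) * ind 1 (suc m) t ∎) (down (suc m)) ⟩
    S m (v ∘ (suc k Nat.+_)) (λ L → c * pow x (suc m) * ind 1 (suc m) L) (down (suc m))
      ≈⟨ S-longest m v (suc k) (c * pow x (suc m)) ⟩
    c * pow x (suc m) * evalMonoFrom R v (suc k) (δ (suc m))
      ≈⟨ *-assoc _ _ _ ⟩
    c * (pow x (suc m) * evalMonoFrom R v (suc k) (δ (suc m)))
      ≈⟨ *-congˡ (*-congʳ (pow-cong (suc m))) ⟩
    c * (pow (v k) (suc m) * evalMonoFrom R v (suc k) (δ (suc m)))
      ≡⟨ ≡.cong (λ e → c * evalMonoFrom R v k e) (δ-suc m) ⟨
    c * evalMonoFrom R v k (δ (2 Nat.+ m)) ∎
    where
    x = v (k Nat.+ 0)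
    pow-cong : ∀ m → pow x m ≈ pow (v k) m
    pow-cong m = reflexive (≡.cong (λ i → pow (v i) m) (Natₚ.+-identityʳ k))

-- Base change, rescaling by length, and the embedding into the extension

module Naturality {a ℓ b ℓ′} (R : CommutativeRing a ℓ) (R′ : CommutativeRing b ℓ′)
  (φ : CommutativeRing.Carrier R → CommutativeRing.Carrier R′)
  (φ-isHom : IsRingHomomorphism (CommutativeRing.rawRing R) (CommutativeRing.rawRing R′) φ)
  (s : CommutativeRing.Carrier R′) where
  open CommutativeRing R′
  open SemiringSolver commutativeSemiring using (solve; _:+_; _:*_; _:=_; con)
  open RingOps R′
  private
    module R = CommutativeRing R
    module O = Operators R
    module O′ = Operators R′
  open IsRingHomomorphism φ-isHom
  open O′.Linear

  -- For κ = `inversions` this is the map e_w ↦ s^ℓ(w) e_w combined with base change along φ. With s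
  -- = 1 it gives naturality in the ring; with a general s it gives homogeneity of the Fomin-Stanley
  -- coefficients.
  twist : (List ℕ → ℕ) → (List ℕ → R.Carrier) → List ℕ → Carrier
  twist κ f L = pow s (κ L) * φ (f L)

  Natural : (O.Op) → (O′.Op) → Set (a ⊔ ℓ′)
  Natural F F′ = ∀ κ → Graded κ → ∀ f L → F′ (twist κ f) L ≈ twist κ (F f) L

  natural-∘ : ∀ {F G} F′ G′ → O′.Linear F′ → Natural F F′ → Natural G G′ → Natural (F ∘ G) (F′ ∘ G′)
  natural-∘ F′ G′ lF nF nG κ gr f L = trans (cong lF (nG κ gr f) L) (nF κ gr _ L)

  natural-shift : ∀ F F′ → Natural F F′ → Natural (O.shift F) (O′.shift F′)
  natural-shift F F′ nF κ gr f []      = refl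
  natural-shift F F′ nF κ gr f (p ∷ t) = nF (κ ∘ (p ∷_)) (λ j L → gr (suc j) (p ∷ L)) (f ∘ (p ∷_)) t

  natural-h₀ : ∀ {x x′} → x′ ≈ s * φ x → Natural (O.h₀ x) (O′.h₀ x′)
  natural-h₀ e κ gr f []       = refl
  natural-h₀ e κ gr f (_ ∷ []) = refl
  natural-h₀ {x} {x′} e κ gr f (p ∷ r ∷ t) with r Nat.<ᵇ p in d
  ... | false = begin
    twist κ f L + x′ * (0# * _)      ≈⟨ +-congˡ (trans (*-congˡ (zeroˡ _)) (zeroʳ _)) ⟩
    twist κ f L + 0#                 ≈⟨ +-identityʳ _ ⟩
    pow s (κ L) * φ (f L)            ≈⟨ *-congˡ (⟦⟧-cong (R.trans (R.+-congˡ
                                          (R.trans (R.*-congˡ (R.zeroˡ _)) (R.zeroʳ _))) (R.+-identityʳ _))) ⟨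
    pow s (κ L) * φ (f L R.+ x R.* (R.0# R.* f (r ∷ p ∷ t))) ∎
    where
    open SetoidReasoning setoid
    L = p ∷ r ∷ t
  ... | true rewrite gr 0 (p ∷ r ∷ t) d = begin
    s * w * φ y + x′ * (1# * (w * φ y′))     ≈⟨ +-congˡ (*-congʳ e) ⟩
    s * w * φ y + s * φ x * (1# * (w * φ y′))
      ≈⟨ solve 5 (λ s w y x y′ → s :* w :* y :+ s :* x :* (con 1 :* (w :* y′))
           := s :* w :* (y :+ x :* y′)) refl s w (φ y) (φ x) (φ y′) ⟩
    s * w * (φ y + φ x * φ y′)     ≈⟨ *-congˡ (+-congˡ (*-homo x y′)) ⟨
    s * w * (φ y + φ (x R.* y′))   ≈⟨ *-congˡ (+-homo _ _) ⟨
    s * w * φ (y R.+ x R.* y′)     ≈⟨ *-congˡ (⟦⟧-cong (R.+-congˡ (R.*-congˡ (R.*-identityˡ y′)))) ⟨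
    s * w * φ (y R.+ x R.* (R.1# R.* y′)) ∎
    where
    open SetoidReasoning setoid
    w  = pow s (κ (r ∷ p ∷ t))
    y  = f (p ∷ r ∷ t)
    y′ = f (r ∷ p ∷ t)

  natural-A : ∀ m {x x′} → x′ ≈ s * φ x → Natural (O.A m x) (O′.A m x′)
  natural-A zero            e κ gr f L = refl
  natural-A (suc m) {x} {x′} e = natural-∘ (O′.h₀ x′) (O′.shift (O′.A m x′)) (O′.h₀-linear x′)
    (natural-h₀ e) (natural-shift (O.A m x) (O′.A m x′) (natural-A m e))

  natural-S : ∀ m {v v′} → (∀ k → v′ k ≈ s * φ (v k)) → Natural (O.S m v) (O′.S m v′)
  natural-S zero             e κ gr f L = refl
  natural-S (suc m) {v} {v′} e = natural-∘ (O′.shift (O′.S m (v′ ∘ suc))) (O′.A (suc m) (v′ 0))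
    (O′.shift-linear (O′.S-linear m (v′ ∘ suc)))
    (natural-shift (O.S m (v ∘ suc)) (O′.S m (v′ ∘ suc)) (natural-S m (e ∘ suc)))
    (natural-A (suc m) (e 0))

module Embedding {a ℓ} (R : CommutativeRing a ℓ) (δ : CommutativeRing.Carrier R) where
  open CommutativeRing R
  open RingProperties ring using (-0#≈0#)
  open QuadraticExtension R δ public
  open SemiringSolver commutativeSemiring using (solve; _:+_; _:*_; _:=_; con)
  module E = CommutativeRing extension

  embed : Carrier → E.Carrier
  embed b = b , 0#

  s : E.Carrier
  s = 0# , 1#

  embed-isHom : IsRingHomomorphism rawRing E.rawRing embed
  embed-isHom = record
    { isSemiringHomomorphism = record
      { isNearSemiringHomomorphism = record
        { +-isMonoidHomomorphism = record
          { isMagmaHomomorphism = record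
            { isRelHomomorphism = record { cong = λ p → p , refl }
            ; homo = λ _ _ → refl , sym (+-identityˡ 0#)
            }
          ; ε-homo = refl , refl
          }
        ; *-homo = λ b b′ → refl , solve 3 (λ δ b b′ →
            con 0 := b :* con 0 :+ con 0 :* b′ :+ δ :* (con 0 :* con 0)) refl δ b b′
        }
      ; 1#-homo = refl , refl
      }
    ; -‿homo = λ _ → refl , sym -0#≈0#
    }

  embed-* : ∀ b x → embed b E.* x E.≈ (b * proj₁ x , b * proj₂ x)
  embed-* b (c , d) = refl , solve 4 (λ δ b c d →
    b :* d :+ con 0 :* c :+ δ :* (con 0 :* d) := b :* d) refl δ b c d

  -- Multiplication by s evaluates the other factor at s = δ.
  s-* : ∀ b d → s E.* (b , d) E.≈ (0# , b + δ * d)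
  s-* b d = zeroˡ b , solve 3 (λ δ b d →
    con 0 :* d :+ con 1 :* b :+ δ :* (con 1 :* d) := b :+ δ :* d) refl δ b d

-- Powers, finite sums and the quotient of a difference of powers

module Sums {a ℓ} (R : CommutativeRing a ℓ) where
  open CommutativeRing R
  open RingOps R
  open RingProperties ring using (-0#≈0#; -‿involutive)
  open SemiringSolver commutativeSemiring using (solve; _:+_; _:*_; _:=_)

  pow-cong : ∀ {x y} n → x ≈ y → pow x n ≈ pow y n
  pow-cong zero    p = refl
  pow-cong (suc n) p = *-cong p (pow-cong n p)

  pow-+ : ∀ x m n → pow x (m Nat.+ n) ≈ pow x m * pow x n
  pow-+ x zero    n = sym (*-identityˡ _)
  pow-+ x (suc m) n = trans (*-congˡ (pow-+ x m n)) (sym (*-assoc _ _ _))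

  pow-* : ∀ x y n → pow x n * pow y n ≈ pow (x * y) n
  pow-* x y zero    = *-identityˡ 1#
  pow-* x y (suc n) = trans
    (solve 4 (λ x y p r → x :* p :* (y :* r) := x :* y :* (p :* r)) refl x y (pow x n) (pow y n))
    (*-congˡ (pow-* x y n))

  pow-swapˡ : ∀ y x b m e → pow y m * (pow x (m Nat.+ e) * b) ≈ (pow y m * pow x m) * (pow x e * b)
  pow-swapˡ y x b m e = trans (*-congˡ (*-congʳ (pow-+ x m e)))
    (solve 4 (λ p r t b → p :* (r :* t :* b) := p :* r :* (t :* b)) refl (pow y m) (pow x m) (pow x e) b)

  pow-swapʳ : ∀ y x b m e → pow y (m Nat.+ e) * (pow x m * b) ≈ (pow y m * pow x m) * (pow y e * b)
  pow-swapʳ y x b m e = trans (*-congʳ (pow-+ y m e))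
    (solve 4 (λ p r t b → p :* t :* (r :* b) := p :* r :* (t :* b)) refl (pow y m) (pow x m) (pow y e) b)

  pow-1 : ∀ n → pow 1# n ≈ 1#
  pow-1 zero    = refl
  pow-1 (suc n) = trans (*-identityˡ _) (pow-1 n)

  sumTo : (ℕ → Carrier) → ℕ → Carrier
  sumTo f d = sumL (applyUpTo f d)

  sumTo-cong : ∀ {f g} d → (∀ i → f i ≈ g i) → sumTo f d ≈ sumTo g d
  sumTo-cong zero    p = refl
  sumTo-cong (suc d) p = +-cong (p 0) (sumTo-cong d (p ∘ suc))

  sumTo-* : ∀ c f d → sumTo (λ i → c * f i) d ≈ c * sumTo f d
  sumTo-* c f zero    = sym (zeroʳ c)
  sumTo-* c f (suc d) = trans (+-congˡ (sumTo-* c (f ∘ suc) d)) (sym (distribˡ _ _ _))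

  intCast-neg : ∀ c → intCast (ℤ.- c) ≈ - intCast c
  intCast-neg (+ zero)  = sym -0#≈0#
  intCast-neg (+ suc n) = refl
  intCast-neg -[1+ n ]  = sym (-‿involutive _)

  evalPoly-++ : ∀ v P Q → evalPoly R v (P ++ Q) ≈ evalPoly R v P + evalPoly R v Q
  evalPoly-++ v []      Q = sym (+-identityˡ _)
  evalPoly-++ v (t ∷ P) Q = trans (+-congˡ (evalPoly-++ v P Q)) (sym (+-assoc _ _ _))

  evalPoly-applyUpTo : ∀ v c e d → evalPoly R v (applyUpTo (λ i → c , e i) d)
                     ≈ intCast c * sumTo (λ i → evalMonoFrom R v 1 (e i)) d
  evalPoly-applyUpTo v c e zero    = sym (zeroʳ _)
  evalPoly-applyUpTo v c e (suc d) =
    trans (+-congˡ (evalPoly-applyUpTo v c (e ∘ suc) d)) (sym (distribˡ _ _ _))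

  -- (xᵈ - yᵈ) / (x - y)
  complete : Carrier → Carrier → ℕ → Carrier
  complete x y d = sumTo (λ i → pow x i * pow y (d ∸ 1 ∸ i)) d

  complete-sucˡ : ∀ x y d → complete x y (suc d) ≈ pow y d + x * complete x y d
  complete-sucˡ x y d = +-cong (*-identityˡ _) (trans
    (sumTo-cong d (λ i → trans (*-assoc _ _ _)
      (*-congˡ (*-congˡ (reflexive (≡.cong (pow y) (≡.sym (Natₚ.∸-+-assoc d 1 i))))))))
    (sumTo-* x _ d))

  complete-sucʳ : ∀ x y d → complete x y (suc d) ≈ pow x d + y * complete x y d
  complete-sucʳ x y zero    = trans (complete-sucˡ x y 0) (+-congˡ (trans (zeroʳ _) (sym (zeroʳ _))))
  complete-sucʳ x y (suc d) = begin
    complete x y (2 Nat.+ d)                           ≈⟨ complete-sucˡ x y (suc d) ⟩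
    y * pow y d + x * complete x y (suc d)             ≈⟨ +-congˡ (*-congˡ (complete-sucʳ x y d)) ⟩
    y * pow y d + x * (pow x d + y * complete x y d)
      ≈⟨ solve 5 (λ x y p r c → y :* p :+ x :* (r :+ y :* c) := x :* r :+ y :* (p :+ x :* c))
           refl x y (pow y d) (pow x d) (complete x y d) ⟩
    x * pow x d + y * (pow y d + x * complete x y d)   ≈⟨ +-congˡ (*-congˡ (complete-sucˡ x y d)) ⟨
    x * pow x d + y * complete x y (suc d) ∎
    where open SetoidReasoning setoid

  -- The left side carries the exponents produced by `∂term`, with m the smaller of the two; the
  -- power of y x pulled out is invariant under the interchange.
  complete-scale : ∀ x y b m d →
    sumTo (λ i → pow x (m Nat.+ i) * (pow y (m Nat.+ (d ∸ 1 ∸ i)) * b)) d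
      ≈ pow (y * x) m * (complete x y d * b)
  complete-scale x y b m d = begin
    sumTo (λ i → pow x (m Nat.+ i) * (pow y (m Nat.+ (d ∸ 1 ∸ i)) * b)) d
      ≈⟨ sumTo-cong d (λ i → trans (*-cong (pow-+ x m i) (*-congʳ (pow-+ y m (d ∸ 1 ∸ i))))
           (solve 5 (λ p p′ r r′ b → p :* p′ :* (r :* r′ :* b) := r :* p :* b :* (p′ :* r′))
             refl (pow x m) (pow x i) (pow y m) (pow y (d ∸ 1 ∸ i)) b)) ⟩
    sumTo (λ i → pow y m * pow x m * b * (pow x i * pow y (d ∸ 1 ∸ i))) d
      ≈⟨ sumTo-* _ _ d ⟩
    pow y m * pow x m * b * complete x y d
      ≈⟨ solve 3 (λ p b c → p :* b :* c := p :* (c :* b)) refl _ b (complete x y d) ⟩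
    pow y m * pow x m * (complete x y d * b)
      ≈⟨ *-congʳ (pow-* y x m) ⟩
    pow (y * x) m * (complete x y d * b) ∎
    where open SetoidReasoning setoid

-- Divided differences as s-components

-- The lift of v to the extension by δ = v i - v (i + 1) that specialises to s_i v at s = 0
-- and to v at s = δ.
module _ {a} {C : Set a} (0′ 1′ -1′ : C) where
  adjacent : ℕ → (ℕ → C) → ℕ → C × C
  adjacent zero    v zero          = v 1 , 1′
  adjacent zero    v (suc zero)    = v 0 , -1′
  adjacent zero    v (suc (suc k)) = v (suc (suc k)) , 0′
  adjacent (suc i) v zero          = v 0 , 0′
  adjacent (suc i) v (suc k)       = adjacent i (v ∘ suc) k

  adjacent-at : ∀ i v → adjacent i v i ≡ (v (suc i) , 1′)
  adjacent-at zero    v = ≡.refl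
  adjacent-at (suc i) v = adjacent-at i (v ∘ suc)

  adjacent-suc : ∀ i v → adjacent i v (suc i) ≡ (v i , -1′)
  adjacent-suc zero    v = ≡.refl
  adjacent-suc (suc i) v = adjacent-suc i (v ∘ suc)

  adjacent-< : ∀ i v k → k < i → adjacent i v k ≡ (v k , 0′)
  adjacent-< (suc i) v zero    _         = ≡.refl
  adjacent-< (suc i) v (suc k) (s≤s k<i) = adjacent-< i (v ∘ suc) k k<i

  adjacent-> : ∀ i v k → adjacent i v (2 Nat.+ (i Nat.+ k)) ≡ (v (2 Nat.+ (i Nat.+ k)) , 0′)
  adjacent-> zero    v k = ≡.refl
  adjacent-> (suc i) v k = adjacent-> i (v ∘ suc) k

-- Evaluated at the adjacent lift v′, a polynomial f becomes f(s_i v) + (∂_i f)(v) s: multiplication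
-- in the extension is the twisted Leibniz rule of ∂_i.
module DividedDifference {a ℓ} (R : CommutativeRing a ℓ) (v : ℕ → CommutativeRing.Carrier R) (i : ℕ) where
  open CommutativeRing R
  open RingOps R
  open RingProperties ring using (-0#≈0#; -‿involutive; -‿distribˡ-*; -‿distribʳ-*; -‿+-comm; -1*x≈-x)
  open SemiringSolver commutativeSemiring using (solve; _:+_; _:*_; _:=_; con)
  open Sums R

  x y : Carrier
  x = v i
  y = v (suc i)

  open Embedding R (x - y) public
  module RE = RingOps extension
  module SE = Sums extension

  v′ : ℕ → E.Carrier
  v′ = adjacent 0# 1# (- 1#) i v

  δ+y : x - y + y ≈ x
  δ+y = trans (+-assoc _ _ _) (trans (+-congˡ (-‿inverseˡ y)) (+-identityʳ x))

  -- The lifts y + s of x_i and x - s of x_{i+1}, named after their values at s = 0.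
  Y X : E.Carrier
  Y = y , 1#
  X = x , - 1#

  x+-δ : x + - (x - y) ≈ y
  x+-δ = trans (+-congʳ (sym δ+y)) (trans (+-congʳ (+-comm _ y))
    (trans (+-assoc _ _ _) (trans (+-congˡ (-‿inverseʳ _)) (+-identityʳ y))))

  -- The s-component is x - y - δ = 0, by s² = δ s: a symmetric expression is unaffected by the
  -- interchange.
  Y*X : Y E.* X E.≈ embed (y * x)
  Y*X = refl , trans
    (+-cong (+-cong (trans (sym (-‿distribʳ-* y 1#)) (-‿cong (*-identityʳ y))) (*-identityˡ x))
       (*-congˡ (*-identityˡ _)))
    (trans (+-congˡ (trans (sym (-‿distribʳ-* _ 1#)) (-‿cong (*-identityʳ _))))
     (trans (+-assoc _ _ _) (trans (+-congˡ x+-δ) (-‿inverseˡ y))))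

  -- `Y` is y at s = 0 and x at s = δ, so the s-component must play the role of the quotient of x^d
  -- - y^d by x - y. The recursion of `complete` replaces the division.
  pow-Y : ∀ d → RE.pow Y d E.≈ (pow y d , complete x y d)
  pow-Y zero    = refl , refl
  pow-Y (suc d) = E.trans (E.*-congˡ {x = Y} (pow-Y d)) (refl , (begin
    y * complete x y d + 1# * pow y d + (x - y) * (1# * complete x y d)
      ≈⟨ solve 4 (λ y δ p c → y :* c :+ con 1 :* p :+ δ :* (con 1 :* c) := p :+ (δ :+ y) :* c)
           refl y (x - y) (pow y d) (complete x y d) ⟩
    pow y d + (x - y + y) * complete x y d   ≈⟨ +-congˡ (*-congʳ δ+y) ⟩
    pow y d + x * complete x y d             ≈⟨ complete-sucˡ x y d ⟨
    complete x y (suc d) ∎))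
    where open SetoidReasoning setoid

  pow-X : ∀ d → RE.pow X d E.≈ (pow x d , - complete x y d)
  pow-X zero    = refl , sym -0#≈0#
  pow-X (suc d) = E.trans (E.*-congˡ {x = X} (pow-X d)) (refl , (begin
    x * - c + - 1# * pow x d + (x - y) * (- 1# * - c)
      ≈⟨ +-cong (+-cong (sym (-‿distribʳ-* x c)) (-1*x≈-x (pow x d)))
           (*-congˡ (trans (-1*x≈-x (- c)) (-‿involutive c))) ⟩
    - (x * c) + - pow x d + (x - y) * c
      ≈⟨ +-congʳ (trans (-‿+-comm _ _) (-‿cong (trans (+-congʳ (*-congʳ (sym δ+y)))
           (solve 4 (λ δ y c p → (δ :+ y) :* c :+ p := δ :* c :+ (p :+ y :* c)) refl (x - y) y c (pow x d))))) ⟩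
    - ((x - y) * c + (pow x d + y * c)) + (x - y) * c
      ≈⟨ +-congʳ (sym (-‿+-comm _ _)) ⟩
    - ((x - y) * c) + - (pow x d + y * c) + (x - y) * c
      ≈⟨ trans (+-congʳ (+-comm _ _)) (trans (+-assoc _ _ _) (trans (+-congˡ (-‿inverseˡ _)) (+-identityʳ _))) ⟩
    - (pow x d + y * c)   ≈⟨ -‿cong (complete-sucʳ x y d) ⟨
    - complete x y (suc d) ∎))
    where
    open SetoidReasoning setoid
    c = complete x y d

  pow-embed : ∀ {b} m → RE.pow (embed b) m E.≈ embed (pow b m)
  pow-embed zero    = refl , refl
  pow-embed {b} (suc m) = E.trans (E.*-congˡ {x = embed b} (pow-embed m))
    (E.trans (embed-* _ _) (refl , zeroʳ _))

  pow-YX : ∀ m → RE.pow Y m E.* RE.pow X m E.≈ embed (pow (y * x) m)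
  pow-YX m = E.trans (SE.pow-* Y X m) (E.trans (SE.pow-cong m Y*X) (pow-embed m))

  sign : ℕ → ℕ → Carrier → Carrier
  sign p r c = if r <ᵇ p then c else - c

  -- The sum over the exponent pairs of `∂term`, for an arbitrary value `f` of the monomial; `sign`
  -- is the accompanying sign.
  terms : (ℕ → ℕ → Carrier) → ℕ → ℕ → Carrier
  terms f p r = sumTo (λ k → f (p ⊓ r Nat.+ k) (p ⊓ r Nat.+ (p ∸ r Nat.+ (r ∸ p) ∸ 1 ∸ k)))
                      (p ∸ r Nat.+ (r ∸ p))

  <ᵇ-+≡false : ∀ p e → (p Nat.+ e <ᵇ p) ≡ false
  <ᵇ-+≡false zero    e = ≡.refl
  <ᵇ-+≡false (suc p) e = <ᵇ-+≡false p e

  <ᵇ-+≡true : ∀ r e → (r <ᵇ r Nat.+ suc e) ≡ true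
  <ᵇ-+≡true zero    e = ≡.refl
  <ᵇ-+≡true (suc r) e = <ᵇ-+≡true r e

  common-power : ∀ m Z d b → proj₂ (Z) ≈ d →
    proj₂ ((RE.pow Y m E.* RE.pow X m) E.* (Z E.* embed b)) ≈ pow (y * x) m * (d * b)
  common-power m Z d b p = trans
    (proj₂ (E.*-cong {x = RE.pow Y m E.* RE.pow X m} {u = Z E.* embed b} (pow-YX m) (E.*-comm Z (embed b))))
    (trans (proj₂ (embed-* (pow (y * x) m) (embed b E.* Z)))
      (*-congˡ (trans (proj₂ (embed-* b Z)) (trans (*-comm _ _) (*-congʳ p)))))

  sign-terms-≤ : ∀ f p e → sign p (p Nat.+ e) (terms f p (p Nat.+ e))
               ≡ - sumTo (λ k → f (p Nat.+ k) (p Nat.+ (e ∸ 1 ∸ k))) e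
  sign-terms-≤ f p e rewrite <ᵇ-+≡false p e | Natₚ.m≤n⇒m⊓n≡m (Natₚ.m≤m+n p e)
    | Natₚ.m≤n⇒m∸n≡0 (Natₚ.m≤m+n p e) | Natₚ.m+n∸m≡n p e = ≡.refl

  sign-terms-> : ∀ f r e → sign (r Nat.+ suc e) r (terms f (r Nat.+ suc e) r)
               ≡ sumTo (λ k → f (r Nat.+ k) (r Nat.+ (e ∸ k))) (suc e)
  sign-terms-> f r e rewrite <ᵇ-+≡true r e | Natₚ.m≥n⇒m⊓n≡n (Natₚ.m≤m+n r (suc e))
    | Natₚ.m+n∸m≡n r (suc e) | Natₚ.m≤n⇒m∸n≡0 (Natₚ.m≤m+n r (suc e)) | Natₚ.+-identityʳ e = ≡.refl

  MonomialDifference : ℕ → ℕ → Carrier → Set ℓ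
  MonomialDifference p r b = proj₂ (RE.pow Y p E.* (RE.pow X r E.* embed b))
                           ≈ sign p r (terms (λ k l → pow x k * (pow y l * b)) p r)

  -- The symmetric part (Y X)^p splits off and leaves X^e. The case p = r belongs here: `∂term` then
  -- takes the minus sign, but its sum is empty.
  monomial-difference-≤ : ∀ p e b → MonomialDifference p (p Nat.+ e) b
  monomial-difference-≤ p e b = begin
    proj₂ (RE.pow Y p E.* (RE.pow X (p Nat.+ e) E.* embed b))
      ≈⟨ proj₂ (SE.pow-swapˡ Y X (embed b) p e) ⟩
    proj₂ ((RE.pow Y p E.* RE.pow X p) E.* (RE.pow X e E.* embed b))
      ≈⟨ common-power p (RE.pow X e) _ b (proj₂ (pow-X e)) ⟩
    pow (y * x) p * (- complete x y e * b)     ≈⟨ *-congˡ (-‿distribˡ-* _ b) ⟨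
    pow (y * x) p * - (complete x y e * b)     ≈⟨ -‿distribʳ-* _ _ ⟨
    - (pow (y * x) p * (complete x y e * b))   ≈⟨ -‿cong (complete-scale x y b p e) ⟨
    - sumTo (λ k → pow x (p Nat.+ k) * (pow y (p Nat.+ (e ∸ 1 ∸ k)) * b)) e
      ≡⟨ sign-terms-≤ (λ k l → pow x k * (pow y l * b)) p e ⟨
    sign p (p Nat.+ e) (terms (λ k l → pow x k * (pow y l * b)) p (p Nat.+ e)) ∎
    where open SetoidReasoning setoid

  monomial-difference-> : ∀ r e b → MonomialDifference (r Nat.+ suc e) r b
  monomial-difference-> r e b = begin
    proj₂ (RE.pow Y (r Nat.+ suc e) E.* (RE.pow X r E.* embed b))
      ≈⟨ proj₂ (SE.pow-swapʳ Y X (embed b) r (suc e)) ⟩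
    proj₂ ((RE.pow Y r E.* RE.pow X r) E.* (RE.pow Y (suc e) E.* embed b))
      ≈⟨ common-power r (RE.pow Y (suc e)) _ b (proj₂ (pow-Y (suc e))) ⟩
    pow (y * x) r * (complete x y (suc e) * b)   ≈⟨ complete-scale x y b r (suc e) ⟨
    sumTo (λ k → pow x (r Nat.+ k) * (pow y (r Nat.+ (e ∸ k)) * b)) (suc e)
      ≡⟨ sign-terms-> (λ k l → pow x k * (pow y l * b)) r e ⟨
    sign (r Nat.+ suc e) r (terms (λ k l → pow x k * (pow y l * b)) (r Nat.+ suc e) r) ∎
    where open SetoidReasoning setoid

  monomial-difference : ∀ p r b → MonomialDifference p r b
  monomial-difference p r b = [ at-≤ , at-> ]′ (Natₚ.≤-<-connex p r)
    where
    at-≤ : p ≤ r → MonomialDifference p r b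
    at-≤ p≤r = ≡.subst (λ r → MonomialDifference p r b) (Natₚ.m+[n∸m]≡n p≤r)
      (monomial-difference-≤ p (r ∸ p) b)
    at-> : r < p → MonomialDifference p r b
    at-> r<p = ≡.subst (λ p → MonomialDifference p r b)
      (≡.trans (Natₚ.+-suc r (p ∸ suc r)) (Natₚ.m+[n∸m]≡n r<p))
      (monomial-difference-> r (p ∸ suc r) b)

  sign-* : ∀ p r b c → b * sign p r c ≈ sign p r (b * c)
  sign-* p r b c with r <ᵇ p
  ... | true  = refl
  ... | false = sym (-‿distribʳ-* b c)

  sign-cong : ∀ p r {b c} → b ≈ c → sign p r b ≈ sign p r c
  sign-cong p r q with r <ᵇ p
  ... | true  = q
  ... | false = -‿cong q

  sign-0 : ∀ p r {c} → c ≈ 0# → 0# ≈ sign p r c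
  sign-0 p r q with r <ᵇ p
  ... | true  = sym q
  ... | false = sym (trans (-‿cong q) -0#≈0#)

  v′-pow : ∀ k d {z} → v′ k ≡ z → RE.pow (v′ k) d E.≈ RE.pow z d
  v′-pow k d eq = SE.pow-cong d (E.reflexive eq)

  EvalMonoEmbeds : Monomial → ℕ → Set ℓ
  EvalMonoEmbeds e k = evalMonoFrom extension v′ k e E.≈ embed (evalMonoFrom R v k e)

  evalMono-> : ∀ k e → EvalMonoEmbeds e (2 Nat.+ (i Nat.+ k))
  evalMono-> k []      = refl , refl
  evalMono-> k (d ∷ e) = E.trans
    (E.*-cong {x = RE.pow (v′ k′) d}
      (E.trans (v′-pow k′ d (adjacent-> 0# 1# (- 1#) i v k)) (pow-embed d))
      (≡.subst (EvalMonoEmbeds e) (≡.cong (2 Nat.+_) (Natₚ.+-suc i k)) (evalMono-> (suc k) e)))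
    (E.trans (embed-* _ _) (refl , zeroʳ _))
    where
    k′ = 2 Nat.+ (i Nat.+ k)

  -- `e` is the tail of an exponent list that starts at the variable of index k, so for k + t = i
  -- the exponents of x_i and x_{i+1} sit at positions t and t + 1.
  EvalMonoDifference : ℕ → Monomial → ℕ → Set ℓ
  EvalMonoDifference t e k = proj₂ (evalMonoFrom extension v′ k e)
    ≈ sign (expAt e t) (expAt e (suc t))
        (terms (λ m l → evalMonoFrom R v k (setAt (setAt e t m) (suc t) l)) (expAt e t) (expAt e (suc t)))

  evalMono-difference-at : ∀ e → EvalMonoDifference 0 e i
  evalMono-difference-at []       = sign-0 0 0 refl
  -- The list stops at x_i, so the exponent of x_{i+1} is read as 0; a factor X⁰ is supplied to
  -- reach the two-variable form.
  evalMono-difference-at (p ∷ []) = begin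
    proj₂ (RE.pow (v′ i) p E.* E.1#)
      ≈⟨ proj₂ (E.*-cong {x = RE.pow (v′ i) p} (v′-pow i p (adjacent-at 0# 1# (- 1#) i v))
           (E.sym (E.*-identityˡ E.1#))) ⟩
    proj₂ (RE.pow Y p E.* (RE.pow X 0 E.* embed 1#))
      ≈⟨ monomial-difference p 0 1# ⟩
    sign p 0 (terms (λ m l → pow x m * (pow y l * 1#)) p 0) ∎
    where open SetoidReasoning setoid
  evalMono-difference-at (p ∷ r ∷ e) = begin
    proj₂ (RE.pow (v′ i) p E.* (RE.pow (v′ (suc i)) r E.* evalMonoFrom extension v′ (2 Nat.+ i) e))
      ≈⟨ proj₂ (E.*-cong {x = RE.pow (v′ i) p} (v′-pow i p (adjacent-at 0# 1# (- 1#) i v))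
           (E.*-cong {x = RE.pow (v′ (suc i)) r} (v′-pow (suc i) r (adjacent-suc 0# 1# (- 1#) i v))
             (≡.subst (EvalMonoEmbeds e) (≡.cong (2 Nat.+_) (Natₚ.+-identityʳ i)) (evalMono-> 0 e)))) ⟩
    proj₂ (RE.pow Y p E.* (RE.pow X r E.* embed (evalMonoFrom R v (2 Nat.+ i) e)))
      ≈⟨ monomial-difference p r _ ⟩
    sign p r (terms (λ m l → pow x m * (pow y l * evalMonoFrom R v (2 Nat.+ i) e)) p r) ∎
    where open SetoidReasoning setoid

  evalMono-difference : ∀ t k e → k Nat.+ t ≡ i → EvalMonoDifference t e k
  evalMono-difference zero k e eq = ≡.subst (EvalMonoDifference 0 e)
    (≡.trans (≡.sym eq) (Natₚ.+-identityʳ k)) (evalMono-difference-at e)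
  evalMono-difference (suc t) k [] eq = sign-0 0 0 refl
  evalMono-difference (suc t) k (d ∷ e) eq = begin
    proj₂ (RE.pow (v′ k) d E.* rest)
      ≈⟨ proj₂ (E.*-congʳ {x = rest} (E.trans (v′-pow k d k-embeds) (pow-embed d))) ⟩
    proj₂ (embed (pow (v k) d) E.* rest)
      ≈⟨ proj₂ (embed-* (pow (v k) d) rest) ⟩
    pow (v k) d * proj₂ rest
      ≈⟨ *-congˡ (evalMono-difference t (suc k) e (≡.trans (≡.sym (Natₚ.+-suc k t)) eq)) ⟩
    pow (v k) d * sign p r (terms f p r)
      ≈⟨ sign-* p r _ _ ⟩
    sign p r (pow (v k) d * terms f p r)
      ≈⟨ sign-cong p r (sumTo-* (pow (v k) d) _ (p ∸ r Nat.+ (r ∸ p))) ⟨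
    sign p r (terms (λ m l → pow (v k) d * f m l) p r) ∎
    where
    open SetoidReasoning setoid
    k-embeds : v′ k ≡ embed (v k)
    k-embeds = adjacent-< 0# 1# (- 1#) i v k (≡.subst (k <_) eq (Natₚ.m<m+n k (s≤s z≤n)))
    rest = evalMonoFrom extension v′ (suc k) e
    p = expAt e t
    r = expAt e (suc t)
    f = λ m l → evalMonoFrom R v (suc k) (setAt (setAt e t m) (suc t) l)

  sign-intCast : ∀ p r c b → intCast (if r <ᵇ p then c else ℤ.- c) * b ≈ intCast c * sign p r b
  sign-intCast p r c b with r <ᵇ p
  ... | true  = refl
  ... | false = trans (*-congʳ (intCast-neg c))
                  (trans (sym (-‿distribˡ-* _ _)) (-‿distribʳ-* _ _))

  evalPoly-∂term : ∀ j → suc j ≡ i → ∀ c e →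
    evalPoly R v (∂term (suc j) (c , e)) ≈ intCast c * proj₂ (evalMonoFrom extension v′ 1 e)
  evalPoly-∂term j eq c e = begin
    evalPoly R v (map (λ k → sgn , mono k) (upTo d))
      ≡⟨ ≡.cong (evalPoly R v) (map-applyUpTo id (λ k → sgn , mono k) d) ⟩
    evalPoly R v (applyUpTo (λ k → sgn , mono k) d)
      ≈⟨ evalPoly-applyUpTo v sgn mono d ⟩
    intCast sgn * sumTo (λ k → evalMonoFrom R v 1 (mono k)) d
      ≈⟨ sign-intCast p r c _ ⟩
    intCast c * sign p r (sumTo (λ k → evalMonoFrom R v 1 (mono k)) d)
      ≈⟨ *-congˡ (evalMono-difference j 1 e eq) ⟨
    intCast c * proj₂ (evalMonoFrom extension v′ 1 e) ∎
    where
    open SetoidReasoning setoid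
    p = expAt e j
    r = expAt e (suc j)
    d = p ∸ r Nat.+ (r ∸ p)
    sgn = if r <ᵇ p then c else ℤ.- c
    mono : ℕ → Monomial
    mono k = setAt (setAt e j (p ⊓ r Nat.+ k)) (suc j) (p ⊓ r Nat.+ (d ∸ 1 ∸ k))

  natCast-embed : ∀ n → RE.natCast n E.≈ embed (natCast n)
  natCast-embed zero    = refl , refl
  natCast-embed (suc n) = E.trans (E.+-congˡ {x = E.1#} (natCast-embed n)) (refl , +-identityˡ 0#)

  intCast-embed : ∀ c → RE.intCast c E.≈ embed (intCast c)
  intCast-embed (+ n)    = natCast-embed n
  intCast-embed -[1+ n ] = E.trans (E.-‿cong (natCast-embed (suc n))) (refl , -0#≈0#)

  evalPoly-∂ : ∀ j → suc j ≡ i → ∀ P →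
    evalPoly R v (∂ (suc j) P) ≈ proj₂ (evalPoly extension v′ P)
  evalPoly-∂ j eq []            = refl
  evalPoly-∂ j eq ((c , e) ∷ P) = begin
    evalPoly R v (∂term (suc j) (c , e) ++ ∂ (suc j) P)
      ≈⟨ evalPoly-++ v (∂term (suc j) (c , e)) (∂ (suc j) P) ⟩
    evalPoly R v (∂term (suc j) (c , e)) + evalPoly R v (∂ (suc j) P)
      ≈⟨ +-cong (evalPoly-∂term j eq c e) (evalPoly-∂ j eq P) ⟩
    intCast c * proj₂ mono + proj₂ (evalPoly extension v′ P)
      ≈⟨ +-congʳ (proj₂ (E.trans (E.*-congʳ {x = mono} (intCast-embed c)) (embed-* (intCast c) mono))) ⟨
    proj₂ (RE.intCast c E.* mono) + proj₂ (evalPoly extension v′ P) ∎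
    where
    open SetoidReasoning setoid
    mono = evalMonoFrom extension v′ 1 e

-- Permutations as lists and their first ascents

record Arrangement (n : ℕ) (L : List ℕ) : Set where
  field
    size   : length L ≡ n
    bounds : All (λ x → 1 ≤ x × x ≤ n) L
    unique : Unique L

All-swapAt : ∀ {P : ℕ → Set} j {L} → All P L → All P (swapAt (suc j) L)
All-swapAt zero    []           = []
All-swapAt zero    (p ∷ [])     = p ∷ []
All-swapAt zero    (p ∷ r ∷ ps) = r ∷ p ∷ ps
All-swapAt (suc j) []           = []
All-swapAt (suc j) (p ∷ ps)     = p ∷ All-swapAt j ps

Unique-swapAt : ∀ j {L} → Unique L → Unique (swapAt (suc j) L)
Unique-swapAt zero    []                           = []
Unique-swapAt zero    (p ∷ [])                     = p ∷ []
Unique-swapAt zero    ((p≢r ∷ ps) ∷ rs ∷ u)        = ((p≢r ∘ ≡.sym) ∷ rs) ∷ ps ∷ u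
Unique-swapAt (suc j) []                           = []
Unique-swapAt (suc j) (p ∷ u)                      = All-swapAt j p ∷ Unique-swapAt j u

length-swapAt : ∀ j L → length (swapAt (suc j) L) ≡ length L
length-swapAt zero    []          = ≡.refl
length-swapAt zero    (_ ∷ [])    = ≡.refl
length-swapAt zero    (_ ∷ _ ∷ _) = ≡.refl
length-swapAt (suc j) []          = ≡.refl
length-swapAt (suc j) (_ ∷ t)     = ≡.cong suc (length-swapAt j t)

Arrangement-swapAt : ∀ j {n L} → Arrangement n L → Arrangement n (swapAt (suc j) L)
Arrangement-swapAt j {L = L} arr = record
  { size   = ≡.trans (length-swapAt j L) (size arr)
  ; bounds = All-swapAt j (bounds arr)
  ; unique = Unique-swapAt j (unique arr)
  }
  where open Arrangement

-- Without an ascent, distinct entries strictly decrease. Being positive they force the head to be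
-- at least the length, and the upper bound leaves no choice.
firstAscent-nothing : ∀ k x t → firstAscent (x ∷ t) k ≡ nothing → Unique (x ∷ t) →
                      All (1 ≤_) (x ∷ t) → x ≤ suc (length t) → x ∷ t ≡ down (suc (length t))
firstAscent-nothing k x [] _ _ (1≤x ∷ []) x≤1 = ≡.cong (_∷ []) (Natₚ.≤-antisym x≤1 1≤x)
firstAscent-nothing k x (y ∷ t) eq ((x≢y ∷ _) ∷ u) (_ ∷ ps) x≤n with x <ᵇ y in b
... | false = ≡.cong₂ _∷_ (Natₚ.≤-antisym x≤n (≤-trans (s≤s (≤-reflexive (≡.sym (proj₁ (∷-injective tail))))) y<x)) tail
  where
  y<x : y < x
  y<x = Natₚ.≤∧≢⇒< (Natₚ.≮⇒≥ (λ x<y → ≡.subst T b (Natₚ.<⇒<ᵇ x<y))) (x≢y ∘ ≡.sym)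
  tail : y ∷ t ≡ down (suc (length t))
  tail = firstAscent-nothing (suc k) y t eq u ps (Nat.s≤s⁻¹ (≤-trans y<x x≤n))

-- Both `nondescent` and `descent` are recorded because on a general list a non-descent may also be
-- a repeated entry or an index past the end.
record Ascent (L : List ℕ) (j : ℕ) : Set where
  field
    nondescent : desc j L ≡ false
    descent    : desc j (swapAt (suc j) L) ≡ true
    position   : suc j < length L

firstAscent-just : ∀ x t k {i} → firstAscent (x ∷ t) k ≡ just i →
                   ∃[ j ] (i ≡ k Nat.+ j × Ascent (x ∷ t) j)
firstAscent-just x (y ∷ t) k eq with x <ᵇ y in b
firstAscent-just x (y ∷ t) k ≡.refl | true = 0 , ≡.sym (Natₚ.+-identityʳ k) , record
  { nondescent = desc-swapAt 0 (y ∷ x ∷ t) b ; descent = b ; position = s≤s (s≤s z≤n) }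
firstAscent-just x (y ∷ t) k eq | false with firstAscent-just y t (suc k) eq
... | j , eq′ , asc = suc j , ≡.trans eq′ (≡.sym (Natₚ.+-suc k j)) , record
  { nondescent = nondescent asc ; descent = descent asc ; position = s≤s (position asc) }
  where open Ascent

schubertAux-nothing : ∀ n fuel L → firstAscent L 1 ≡ nothing → schubertAux n fuel L ≡ (+ 1 , δ n) ∷ []
schubertAux-nothing n fuel L eq rewrite eq = ≡.refl

schubertAux-just : ∀ n fuel L {i} → firstAscent L 1 ≡ just i →
                   schubertAux n (suc fuel) L ≡ ∂ i (schubertAux n fuel (swapAt i L))
schubertAux-just n fuel L eq rewrite eq = ≡.refl

data AscentView (n : ℕ) (L : List ℕ) : Set where
  longest : firstAscent L 1 ≡ nothing → L ≡ down n → AscentView n L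
  ascent  : ∀ j → firstAscent L 1 ≡ just (suc j) → Ascent L j → AscentView n L

ascentView : ∀ {m L} → Arrangement (suc m) L → AscentView (suc m) L
ascentView {L = []} arr with Arrangement.size arr
... | ()
ascentView {L = x ∷ t} arr with firstAscent (x ∷ t) 1 in eq
... | nothing = longest eq (≡.trans
    (firstAscent-nothing 1 x t eq unique (All.map proj₁ bounds)
      (≤-trans (proj₂ (All.head bounds)) (≤-reflexive (≡.sym size))))
    (≡.cong down size))
  where open Arrangement arr
... | just i with firstAscent-just x t 1 eq
... | j , ≡.refl , asc = ascent j eq asc

-- A crude bound, chosen to match the fuel n * n of `schubert`.
inversions-≤ : ∀ L → inversions L ≤ length L Nat.* length L
inversions-≤ []      = z≤n
inversions-≤ (p ∷ t) = Natₚ.+-mono-≤ (≤-trans (length-filter _ t) (Natₚ.n≤1+n (length t)))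
  (≤-trans (inversions-≤ t) (Natₚ.*-monoʳ-≤ (length t) (Natₚ.n≤1+n (length t))))

inversions-ascent : ∀ {L j} → Ascent L j → inversions (swapAt (suc j) L) ≡ suc (inversions L)
inversions-ascent {L} {j} asc = ≡.trans (inversions-descent j (swapAt (suc j) L) (Ascent.descent asc))
  (≡.cong (suc ∘ inversions) (swapAt-involutive j L))

-- Schubert polynomials as coefficients of the Fomin-Stanley product

module _ {a ℓ b ℓ′} (R : CommutativeRing a ℓ) (R′ : CommutativeRing b ℓ′)
  (φ : CommutativeRing.Carrier R → CommutativeRing.Carrier R′)
  (φ-isHom : IsRingHomomorphism (CommutativeRing.rawRing R) (CommutativeRing.rawRing R′) φ) where
  open CommutativeRing R′
  private
    module O = Operators R
    module O′ = Operators R′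

  -- Rescaling with s = 1, so that only the base change remains.
  S-natural : ∀ m {v v′ f f′} → (∀ k → v′ k ≈ φ (v k)) → (∀ L → f′ L ≈ φ (f L)) →
              ∀ L → O′.S m v′ f′ L ≈ φ (O.S m v f L)
  S-natural m {v} {v′} {f} {f′} p r L = begin
    O′.S m v′ f′ L
      ≈⟨ O′.Linear.cong (O′.S-linear m v′) (λ L → trans (r L) (sym (untwist L (φ (f L))))) L ⟩
    O′.S m v′ (N.twist inversions f) L
      ≈⟨ N.natural-S m (λ k → trans (p k) (sym (*-identityˡ _))) inversions inversions-descent f L ⟩
    N.twist inversions (O.S m v f) L
      ≈⟨ untwist L _ ⟩
    φ (O.S m v f L) ∎
    where
    open SetoidReasoning setoid
    module N = Naturality R R′ φ φ-isHom 1#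
    untwist : ∀ L x → RingOps.pow R′ 1# (inversions L) * x ≈ x
    untwist L x = trans (*-congʳ (Sums.pow-1 R′ (inversions L))) (*-identityˡ x)

  ind-natural : ∀ k m L → OperatorValues.ind R′ k m L ≈ φ (OperatorValues.ind R k m L)
  ind-natural k m L with eqListᵇ (range k m) L
  ... | true  = sym (IsRingHomomorphism.1#-homo φ-isHom)
  ... | false = sym (IsRingHomomorphism.0#-homo φ-isHom)

-- Over the extension the Fomin-Stanley product at u′ is the one at s_j u times 1 + s e_j, so its
-- s-component is that product times e_j: this is ∂_j 𝔖 = 𝔖 e_j without any division.
module ExchangeStep {a ℓ} (R : CommutativeRing a ℓ) (u : ℕ → CommutativeRing.Carrier R)
  (j m : ℕ) (j<m : j < m) where
  open CommutativeRing R
  open RingProperties ring using (-‿distribʳ-*)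
  open Operators R
  open OperatorValues R
  private
    δ′ = u j - u (suc j)
  open Embedding R δ′
  private
    module OE = Operators extension
    module VE = OperatorValues extension

  u′ : ℕ → E.Carrier
  u′ = adjacent 0# 1# (- 1#) j u

  -- The variables with entries j and j + 1 interchanged, read off as the values of `u′` at s = 0.
  w : ℕ → Carrier
  w = proj₁ ∘ u′

  w-< : ∀ k → k < j → u k ≈ w k
  w-< k k<j = reflexive (≡.sym (≡.cong proj₁ (adjacent-< 0# 1# (- 1#) j u k k<j)))

  w-at : w j ≡ u (suc j)
  w-at = ≡.cong proj₁ (adjacent-at 0# 1# (- 1#) j u)

  w-suc : w (suc j) ≡ u j
  w-suc = ≡.cong proj₁ (adjacent-suc 0# 1# (- 1#) j u)

  w-> : ∀ k → u (2 Nat.+ (j Nat.+ k)) ≈ w (2 Nat.+ (j Nat.+ k))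
  w-> k = reflexive (≡.sym (≡.cong proj₁ (adjacent-> 0# 1# (- 1#) j u k)))

  δ+u : u j ≈ u (suc j) + δ′
  δ+u = sym (trans (+-comm _ _) (trans (+-assoc _ _ _)
    (trans (+-congˡ (-‿inverseˡ _)) (+-identityʳ _))))

  -- Applied at lists without a descent at j, where `h` does nothing: those coefficients are
  -- symmetric in the two variables.
  S-u : ∀ f → S m u f ≋ h j δ′ (S m w f)
  S-u = S-symmetry j m j<m w-<
    (trans δ+u (+-congʳ (reflexive (≡.sym w-at))))
    (trans (reflexive w-suc) δ+u)
    (*-congˡ (reflexive w-at))
    w->

  -- The exchange with g = s. Its condition s w_j = s u′_{j+1} holds although the two elements may
  -- differ: both are u_{j+1} at s = δ.
  S-u′ : ∀ f → OE.S m u′ f OE.≋ OE.h j s (OE.S m (embed ∘ w) f)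
  S-u′ = OE.S-symmetry j m j<m
    (λ k k<j → lift k (adjacent-< 0# 1# (- 1#) j u k k<j))
    (E.trans (E.reflexive at) (E.trans (sym (+-identityʳ _) , sym (+-identityˡ _))
      (E.+-congʳ {x = s} (E.reflexive (≡.cong embed (≡.sym w-at))))))
    (E.trans (E.reflexive (≡.cong embed w-suc)) (E.trans (sym (+-identityʳ _) , sym (-‿inverseˡ 1#))
      (E.+-congʳ {x = s} (E.reflexive (≡.sym at-suc)))))
    (E.trans (E.*-congˡ {x = s} (E.reflexive (≡.cong embed w-at)))
      (E.trans s-*-embed (E.*-congˡ {x = s} (E.reflexive (≡.sym at-suc)))))
    (λ k → lift (2 Nat.+ (j Nat.+ k)) (adjacent-> 0# 1# (- 1#) j u k))
    where
    at : u′ j ≡ (u (suc j) , 1#)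
    at = adjacent-at 0# 1# (- 1#) j u
    at-suc : u′ (suc j) ≡ (u j , - 1#)
    at-suc = adjacent-suc 0# 1# (- 1#) j u
    lift : ∀ k {z} → u′ k ≡ (z , 0#) → u′ k E.≈ embed (w k)
    lift k p = refl , reflexive (≡.cong proj₂ p)
    s-*-embed : s E.* embed (u (suc j)) E.≈ s E.* (u j , - 1#)
    s-*-embed = E.trans (s-* _ _) (E.trans (refl , (begin
        u (suc j) + δ′ * 0#       ≈⟨ trans (+-congˡ (zeroʳ _)) (+-identityʳ _) ⟩
        u (suc j)                 ≈⟨ trans (+-assoc _ _ _) (trans (+-congˡ (-‿inverseʳ _)) (+-identityʳ _)) ⟨
        u (suc j) + δ′ - δ′       ≈⟨ +-congʳ δ+u ⟨
        u j - δ′                  ≈⟨ +-congˡ (trans (sym (-‿distribʳ-* _ _)) (-‿cong (*-identityʳ _))) ⟨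
        u j + δ′ * - 1# ∎)) (E.sym (s-* _ _)))
      where
      open SetoidReasoning setoid

  exchange-step : ∀ n L → Ascent L j →
    proj₂ (OE.S m u′ (VE.ind 1 n) (swapAt (suc j) L)) ≈ S m u (ind 1 n) L
  exchange-step n L asc = begin
    proj₂ (OE.S m u′ (VE.ind 1 n) L′)
      ≈⟨ proj₂ (S-u′ (VE.ind 1 n) L′) ⟩
    proj₂ (OE.h j s F L′)
      ≈⟨ proj₂ (VE.h-descent j L′ (Ascent.descent asc)) ⟩
    proj₂ (F L′) + proj₂ (s E.* F (swapAt (suc j) L′))
      ≈⟨ +-cong (proj₂ (natural L′)) (trans
           (proj₂ (E.*-congˡ {x = s} (E.trans (E.reflexive (≡.cong F (swapAt-involutive j L))) (natural L))))
           (proj₂ (s-* (S m w (ind 1 n) L) 0#))) ⟩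
    0# + (S m w (ind 1 n) L + δ′ * 0#)
      ≈⟨ trans (+-identityˡ _) (trans (+-congˡ (zeroʳ _)) (+-identityʳ _)) ⟩
    -- The interchange is undone at no cost, since `L` has no descent at j.
    S m w (ind 1 n) L
      ≈⟨ h-nondescent j L (Ascent.nondescent asc) ⟨
    h j δ′ (S m w (ind 1 n)) L
      ≈⟨ S-u (ind 1 n) L ⟨
    S m u (ind 1 n) L ∎
    where
    open SetoidReasoning setoid
    L′ = swapAt (suc j) L
    F = OE.S m (embed ∘ w) (VE.ind 1 n)
    natural : ∀ L → F L E.≈ embed (S m w (ind 1 n) L)
    natural = S-natural R extension embed embed-isHom m (λ k → E.refl)
      (ind-natural R extension embed embed-isHom 1 n)

evalPoly-longest : ∀ {a ℓ} (R : CommutativeRing a ℓ) m v →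
  let open CommutativeRing R in evalPoly R v ((+ 1 , δ (suc m)) ∷ [])
    ≈ Operators.S R m (v ∘ suc) (OperatorValues.ind R 1 (suc m)) (down (suc m))
evalPoly-longest R m v = begin
  (1# + 0#) * evalMonoFrom R v 1 (δ (suc m)) + 0#
    ≈⟨ trans (+-identityʳ _) (*-congʳ (+-identityʳ 1#)) ⟩
  1# * evalMonoFrom R v 1 (δ (suc m))
    ≈⟨ S-longest m v 1 1# ⟨
  S m (v ∘ suc) (λ L → 1# * ind 1 (suc m) L) (down (suc m))
    ≈⟨ Linear.cong (S-linear m _) (λ L → *-identityˡ _) (down (suc m)) ⟩
  S m (v ∘ suc) (ind 1 (suc m)) (down (suc m)) ∎
  where
  open CommutativeRing R
  open Operators R
  open OperatorValues R
  open SetoidReasoning setoid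

-- The ring has to vary: an ascent invokes the claim over an extension of it. The bound is preserved
-- because a step spends one unit of fuel and adds one inversion.
evalPoly-schubertAux : ∀ {a ℓ} (R : CommutativeRing a ℓ) m fuel L v →
  Arrangement (suc m) L → suc m Nat.* suc m ≤ inversions L Nat.+ fuel →
  let open CommutativeRing R in
  evalPoly R v (schubertAux (suc m) fuel L) ≈ Operators.S R m (v ∘ suc) (OperatorValues.ind R 1 (suc m)) L

evalPoly-ascent : ∀ {a ℓ} (R : CommutativeRing a ℓ) m fuel L v →
  Arrangement (suc m) L → suc m Nat.* suc m ≤ inversions L Nat.+ suc fuel → ∀ j → Ascent L j →
  let open CommutativeRing R in
  evalPoly R v (∂ (suc j) (schubertAux (suc m) fuel (swapAt (suc j) L)))
    ≈ Operators.S R m (v ∘ suc) (OperatorValues.ind R 1 (suc m)) L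

evalPoly-schubertAux R m fuel L v arr bound with ascentView arr
evalPoly-schubertAux R m fuel L v arr bound | longest eq L≡down =
  trans (reflexive (≡.cong (evalPoly R v) (schubertAux-nothing (suc m) fuel L eq)))
    (trans (evalPoly-longest R m v)
      (reflexive (≡.cong (Operators.S R m (v ∘ suc) (OperatorValues.ind R 1 (suc m))) (≡.sym L≡down))))
  where open CommutativeRing R
-- Out of fuel, `L` would already have at least (m + 1)² inversions, and the swapped list one more,
-- beyond what its length allows.
evalPoly-schubertAux R m zero L v arr bound | ascent j eq asc =
  ⊥-elim (Natₚ.<-irrefl ≡.refl (begin-strict
    inversions L                     <⟨ ≤-refl ⟩
    suc (inversions L)               ≡⟨ inversions-ascent {L} asc ⟨
    inversions L′                    ≤⟨ inversions-≤ L′ ⟩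
    length L′ Nat.* length L′        ≡⟨ ≡.cong (λ n → n Nat.* n) (Arrangement.size (Arrangement-swapAt j arr)) ⟩
    suc m Nat.* suc m                ≤⟨ bound ⟩
    inversions L Nat.+ 0             ≡⟨ Natₚ.+-identityʳ _ ⟩
    inversions L ∎))
  where
  open Natₚ.≤-Reasoning
  L′ = swapAt (suc j) L
evalPoly-schubertAux R m (suc fuel) L v arr bound | ascent j eq asc =
  trans (reflexive (≡.cong (evalPoly R v) (schubertAux-just (suc m) fuel L eq)))
    (evalPoly-ascent R m fuel L v arr bound j asc)
  where open CommutativeRing R

evalPoly-ascent R m fuel L v arr bound j asc = begin
  evalPoly R v (∂ (suc j) P)
    ≈⟨ evalPoly-∂ j ≡.refl P ⟩
  proj₂ (evalPoly extension v′ P)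
    ≈⟨ proj₂ (evalPoly-schubertAux extension m fuel L′ v′ (Arrangement-swapAt j arr) bound′) ⟩
  proj₂ (Operators.S extension m u′ (OperatorValues.ind extension 1 (suc m)) L′)
    ≈⟨ exchange-step (suc m) L asc ⟩
  Operators.S R m (v ∘ suc) (OperatorValues.ind R 1 (suc m)) L ∎
  where
  open CommutativeRing R
  open SetoidReasoning setoid
  open DividedDifference R v (suc j)
  open ExchangeStep R (v ∘ suc) j m
    (Nat.s≤s⁻¹ (≤-trans (Ascent.position asc) (≤-reflexive (Arrangement.size arr))))
  L′ = swapAt (suc j) L
  P  = schubertAux (suc m) fuel L′
  bound′ : suc m Nat.* suc m ≤ inversions L′ Nat.+ fuel
  bound′ = ≤-trans bound (≤-reflexive (≡.trans (Natₚ.+-suc (inversions L) fuel)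
    (≡.cong (Nat._+ fuel) (≡.sym (inversions-ascent {L} asc)))))

-- Words and the permutations they represent

letters : ℕ → List ℕ
letters n = map suc (upTo (n ∸ 1))

range≡ : ∀ k m → applyUpTo (k Nat.+_) m ≡ range k m
range≡ k zero    = ≡.refl
range≡ k (suc m) = ≡.cong₂ _∷_ (Natₚ.+-identityʳ k)
  (≡.trans (applyUpTo-cong m (Natₚ.+-suc k)) (range≡ (suc k) m))
  where
  applyUpTo-cong : ∀ {f g : ℕ → ℕ} m → (∀ i → f i ≡ g i) → applyUpTo f m ≡ applyUpTo g m
  applyUpTo-cong zero    p = ≡.refl
  applyUpTo-cong (suc m) p = ≡.cong₂ _∷_ (p 0) (applyUpTo-cong m (p ∘ suc))

identity≡range : ∀ n → map suc (upTo n) ≡ range 1 n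
identity≡range n = ≡.trans (map-applyUpTo id suc n) (range≡ 1 n)

sℕ-fixes : ∀ a m → m ≢ a → m ≢ suc a → sℕ a m ≡ m
sℕ-fixes a m p r with m Nat.≡ᵇ a in e | m Nat.≡ᵇ suc a in e′
... | true  | _     = ⊥-elim (p (Natₚ.≡ᵇ⇒≡ m a (≡.subst T (≡.sym e) _)))
... | false | true  = ⊥-elim (r (Natₚ.≡ᵇ⇒≡ m (suc a) (≡.subst T (≡.sym e′) _)))
... | false | false = ≡.refl

sℕ-left : ∀ a → sℕ a a ≡ suc a
sℕ-left a rewrite ≡ᵇ-refl a = ≡.refl

sℕ-right : ∀ a → sℕ a (suc a) ≡ a
sℕ-right a with suc a Nat.≡ᵇ a in e
... | true  = ⊥-elim (Natₚ.1+n≢n (Natₚ.≡ᵇ⇒≡ (suc a) a (≡.subst T (≡.sym e) _)))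
... | false rewrite ≡ᵇ-refl a = ≡.refl

map-sℕ-above : ∀ a k m → suc a < k → map (sℕ a) (range k m) ≡ range k m
map-sℕ-above a k zero    p = ≡.refl
map-sℕ-above a k (suc m) p = ≡.cong₂ _∷_
  (sℕ-fixes a k (λ e → Natₚ.<-irrefl (≡.sym e) (Natₚ.<-trans (Natₚ.n<1+n a) p)) (λ e → Natₚ.<-irrefl (≡.sym e) p))
  (map-sℕ-above a (suc k) m (Natₚ.m<n⇒m<1+n p))

-- On an interval in increasing order, exchanging two adjacent values is the same as exchanging two
-- positions.
map-sℕ-range : ∀ j k m → suc j < m → map (sℕ (k Nat.+ j)) (range k m) ≡ swapAt (suc j) (range k m)
map-sℕ-range zero k (suc zero) (s≤s ())
map-sℕ-range zero k (suc (suc m)) _ rewrite Natₚ.+-identityʳ k =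
  ≡.cong₂ _∷_ (sℕ-left k) (≡.cong₂ _∷_ (sℕ-right k) (map-sℕ-above k (2 Nat.+ k) m ≤-refl))
map-sℕ-range (suc j) k (suc m) (s≤s p) = ≡.cong₂ _∷_
  (sℕ-fixes (k Nat.+ suc j) k (Natₚ.<⇒≢ k<) (Natₚ.<⇒≢ (Natₚ.m<n⇒m<1+n k<)))
  (≡.trans (≡.cong (λ a → map (sℕ a) (range (suc k) m)) (Natₚ.+-suc k j)) (map-sℕ-range j (suc k) m p))
  where
  k< : k < k Nat.+ suc j
  k< = Natₚ.m<m+n k (s≤s z≤n)

map-swapAt : ∀ (f : ℕ → ℕ) j L → map f (swapAt (suc j) L) ≡ swapAt (suc j) (map f L)
map-swapAt f zero    []          = ≡.refl
map-swapAt f zero    (_ ∷ [])    = ≡.refl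
map-swapAt f zero    (_ ∷ _ ∷ _) = ≡.refl
map-swapAt f (suc j) []          = ≡.refl
map-swapAt f (suc j) (x ∷ L)     = ≡.cong (f x ∷_) (map-swapAt f j L)

eqListᵇ-swapAt : ∀ j L M → eqListᵇ (swapAt (suc j) L) M ≡ eqListᵇ L (swapAt (suc j) M)
eqListᵇ-swapAt zero [] []          = ≡.refl
eqListᵇ-swapAt zero [] (_ ∷ [])    = ≡.refl
eqListᵇ-swapAt zero [] (_ ∷ _ ∷ _) = ≡.refl
eqListᵇ-swapAt zero (_ ∷ []) []          = ≡.refl
eqListᵇ-swapAt zero (_ ∷ []) (_ ∷ [])    = ≡.refl
eqListᵇ-swapAt zero (_ ∷ []) (_ ∷ _ ∷ _) = ≡.trans (∧-zeroʳ _) (≡.sym (∧-zeroʳ _))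
eqListᵇ-swapAt zero (_ ∷ _ ∷ _) []          = ≡.refl
eqListᵇ-swapAt zero (_ ∷ _ ∷ _) (_ ∷ [])    = ≡.trans (∧-zeroʳ _) (≡.sym (∧-zeroʳ _))
eqListᵇ-swapAt zero (x ∷ y ∷ L) (p ∷ r ∷ M) = begin
  (y Nat.≡ᵇ p) ∧ ((x Nat.≡ᵇ r) ∧ eqListᵇ L M)   ≡⟨ ∧-assoc (y Nat.≡ᵇ p) _ _ ⟨
  ((y Nat.≡ᵇ p) ∧ (x Nat.≡ᵇ r)) ∧ eqListᵇ L M   ≡⟨ ≡.cong (_∧ eqListᵇ L M) (∧-comm (y Nat.≡ᵇ p) _) ⟩
  ((x Nat.≡ᵇ r) ∧ (y Nat.≡ᵇ p)) ∧ eqListᵇ L M   ≡⟨ ∧-assoc (x Nat.≡ᵇ r) _ _ ⟩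
  (x Nat.≡ᵇ r) ∧ ((y Nat.≡ᵇ p) ∧ eqListᵇ L M) ∎
  where open ≡.≡-Reasoning
eqListᵇ-swapAt (suc j) [] []           = ≡.refl
eqListᵇ-swapAt (suc j) [] (_ ∷ _)      = ≡.refl
eqListᵇ-swapAt (suc j) (_ ∷ _) []      = ≡.refl
eqListᵇ-swapAt (suc j) (x ∷ L) (p ∷ M) = ≡.cong ((x Nat.≡ᵇ p) ∧_) (eqListᵇ-swapAt j L M)

actW-∷ʳ : ∀ w a m → actW (w ∷ʳ a) m ≡ actW w (sℕ a m)
actW-∷ʳ []      a m = ≡.refl
actW-∷ʳ (b ∷ w) a m = ≡.cong (sℕ b) (actW-∷ʳ w a m)

-- The last letter acts first, on the arguments, hence it permutes positions; being an involution,
-- it can be moved to the other side of the equation.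
represents-∷ʳ : ∀ n L w j → suc j < n →
                representsᵇ n L (w ∷ʳ suc j) ≡ representsᵇ n (swapAt (suc j) L) w
represents-∷ʳ n L w j p = begin
  eqListᵇ (map (actW (w ∷ʳ suc j)) idₙ) L             ≡⟨ ≡.cong (λ M → eqListᵇ M L) (map-cong (actW-∷ʳ w (suc j)) idₙ) ⟩
  eqListᵇ (map (actW w ∘ sℕ (suc j)) idₙ) L           ≡⟨ ≡.cong (λ M → eqListᵇ M L) (map-∘ idₙ) ⟩
  eqListᵇ (map (actW w) (map (sℕ (suc j)) idₙ)) L     ≡⟨ ≡.cong (λ M → eqListᵇ (map (actW w) M) L) swap-id ⟩
  eqListᵇ (map (actW w) (swapAt (suc j) idₙ)) L       ≡⟨ ≡.cong (λ M → eqListᵇ M L) (map-swapAt (actW w) j idₙ) ⟩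
  eqListᵇ (swapAt (suc j) (map (actW w) idₙ)) L       ≡⟨ eqListᵇ-swapAt j (map (actW w) idₙ) L ⟩
  eqListᵇ (map (actW w) idₙ) (swapAt (suc j) L) ∎
  where
  open ≡.≡-Reasoning
  idₙ = map suc (upTo n)
  swap-id : map (sℕ (suc j)) idₙ ≡ swapAt (suc j) idₙ
  swap-id rewrite identity≡range n = map-sℕ-range j 1 n p

represents-[] : ∀ n L → representsᵇ n L [] ≡ eqListᵇ (range 1 n) L
represents-[] n L = ≡.cong (λ M → eqListᵇ M L)
  (≡.trans (map-id _) (identity≡range n))

eqListᵇ⇒≡ : ∀ L M → eqListᵇ L M ≡ true → L ≡ M
eqListᵇ⇒≡ []      []      _ = ≡.refl
eqListᵇ⇒≡ (x ∷ L) (y ∷ M) e with x Nat.≡ᵇ y in b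
... | true = ≡.cong₂ _∷_ (Natₚ.≡ᵇ⇒≡ x y (≡.subst T (≡.sym b) _)) (eqListᵇ⇒≡ L M e)

inversions-range : ∀ k m → inversions (range k m) ≡ 0
inversions-range k zero    = ≡.refl
inversions-range k (suc m) rewrite inversions-range (suc k) m = ≡.trans (Natₚ.+-identityʳ _) (below-range k (suc k) m (Natₚ.n≤1+n k))
  where
  below-range : ∀ x k m → x ≤ k → below x (range k m) ≡ 0
  below-range x k zero    _ = ≡.refl
  below-range x k (suc m) p rewrite below-∷ x k (range (suc k) m) with k <ᵇ x in b
  ... | true  = ⊥-elim (Natₚ.<-irrefl ≡.refl (≤-trans (Natₚ.<ᵇ⇒< k x (≡.subst T (≡.sym b) _)) p))
  ... | false = below-range x (suc k) m (Natₚ.m≤n⇒m≤1+n p)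

inversions-swapAt-≥ : ∀ j L → inversions L ≤ suc (inversions (swapAt (suc j) L))
inversions-swapAt-≥ j L with desc j L in d
... | true  = ≤-reflexive (inversions-descent j L d)
... | false = Natₚ.m≤n⇒m≤1+n (inversions-nondescent j L d)

-- Only the pair b, a is new, and b occupies position k + length w.
comajFrom-∷ʳ : ∀ k w b a → comajFrom k (w ∷ʳ b ∷ʳ a)
             ≡ comajFrom k (w ∷ʳ b) Nat.+ (if b <ᵇ a then k Nat.+ length w else 0)
comajFrom-∷ʳ k []          b a = ≡.trans (Natₚ.+-identityʳ _)
  (≡.cong (λ m → if b <ᵇ a then m else 0) (≡.sym (Natₚ.+-identityʳ k)))
comajFrom-∷ʳ k (c ∷ [])    b a = ≡.trans
  (≡.cong ((if c <ᵇ b then k else 0) Nat.+_) (≡.trans (comajFrom-∷ʳ (suc k) [] b a) (≡.cong (λ m → if b <ᵇ a then m else 0) (≡.sym (Natₚ.+-suc k 0)))))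
  (≡.sym (Natₚ.+-assoc (if c <ᵇ b then k else 0) 0 _))
comajFrom-∷ʳ k (c ∷ d ∷ w) b a = ≡.trans
  (≡.cong ((if c <ᵇ d then k else 0) Nat.+_) (≡.trans (comajFrom-∷ʳ (suc k) (d ∷ w) b a)
    (≡.cong (λ m → comajFrom (suc k) (d ∷ w ∷ʳ b) Nat.+ (if b <ᵇ a then m else 0))
      (≡.sym (Natₚ.+-suc k (length (d ∷ w)))))))
  (≡.sym (Natₚ.+-assoc (if c <ᵇ d then k else 0) _ _))

letter-< : ∀ n {i} → i < n ∸ 1 → suc i < n
letter-< (suc n) p = s≤s p

-- Sums over words

module WordSums {a ℓ} (R : CommutativeRing a ℓ) where
  open CommutativeRing R
  open RingOps R
  open Sums R
  open SetoidReasoning setoid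
  open CommutativeSemigroupProperties
    (CommutativeMonoid.commutativeSemigroup +-commutativeMonoid) using (interchange)

  sum : ∀ {x} {X : Set x} → (X → Carrier) → List X → Carrier
  sum f xs = sumL (map f xs)

  sum-cong : ∀ {x} {X : Set x} {f g : X → Carrier} → (∀ w → f w ≈ g w) → ∀ xs → sum f xs ≈ sum g xs
  sum-cong p []       = refl
  sum-cong p (w ∷ xs) = +-cong (p w) (sum-cong p xs)

  sum-0 : ∀ {x} {X : Set x} (xs : List X) → sum (λ _ → 0#) xs ≈ 0#
  sum-0 []       = refl
  sum-0 (_ ∷ xs) = trans (+-identityˡ _) (sum-0 xs)

  sum-+ : ∀ {x} {X : Set x} (f g : X → Carrier) xs → sum (λ w → f w + g w) xs ≈ sum f xs + sum g xs
  sum-+ f g []       = sym (+-identityˡ 0#)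
  sum-+ f g (w ∷ xs) = trans (+-congˡ (sum-+ f g xs)) (interchange _ _ _ _)

  sum-* : ∀ {x} {X : Set x} c (f : X → Carrier) xs → sum (λ w → c * f w) xs ≈ c * sum f xs
  sum-* c f []       = sym (zeroʳ c)
  sum-* c f (w ∷ xs) = trans (+-congˡ (sum-* c f xs)) (sym (distribˡ _ _ _))

  sum-++ : ∀ {x} {X : Set x} (f : X → Carrier) xs ys → sum f (xs ++ ys) ≈ sum f xs + sum f ys
  sum-++ f []       ys = sym (+-identityˡ _)
  sum-++ f (w ∷ xs) ys = trans (+-congˡ (sum-++ f xs ys)) (sym (+-assoc _ _ _))

  sum-swap : ∀ {x y} {X : Set x} {Y : Set y} (f : X → Y → Carrier) xs ys →
             sum (λ v → sum (f v) ys) xs ≈ sum (λ w → sum (λ v → f v w) xs) ys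
  sum-swap f []       ys = sym (sum-0 ys)
  sum-swap f (v ∷ xs) ys = trans (+-congˡ (sum-swap f xs ys)) (sym (sum-+ (f v) _ ys))

  sum-concatMap : ∀ {x y} {X : Set x} {Y : Set y} (f : Y → Carrier) (g : X → List Y) xs →
                  sum f (concatMap g xs) ≈ sum (λ v → sum f (g v)) xs
  sum-concatMap f g []       = refl
  sum-concatMap f g (v ∷ xs) = trans (sum-++ f (g v) (concatMap g xs)) (+-congˡ (sum-concatMap f g xs))

  sum-filter : ∀ {x} {X : Set x} (f : X → Carrier) (P : X → Bool) xs →
               sum f (filterᵇ P xs) ≈ sum (λ w → if P w then f w else 0#) xs
  sum-filter f P []       = refl
  sum-filter f P (w ∷ xs) with P w
  ... | true  = +-congˡ (sum-filter f P xs)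
  ... | false = trans (sum-filter f P xs) (sym (+-identityˡ _))

  sumTo-suc : ∀ f d → sumTo f (suc d) ≈ sumTo f d + f d
  sumTo-suc f zero    = +-comm _ _
  sumTo-suc f (suc d) = trans (+-congˡ (sumTo-suc (f ∘ suc) d)) (sym (+-assoc _ _ _))

  sumTo-+ : ∀ f g d → sumTo (λ i → f i + g i) d ≈ sumTo f d + sumTo g d
  sumTo-+ f g zero    = sym (+-identityˡ 0#)
  sumTo-+ f g (suc d) = trans (+-congˡ (sumTo-+ (f ∘ suc) (g ∘ suc) d)) (interchange _ _ _ _)

  sumTo-cut : ∀ f j d → sumTo (λ i → if i <ᵇ j then f i else 0#) (j Nat.+ d) ≈ sumTo f j
  sumTo-cut f zero    zero    = refl
  sumTo-cut f zero    (suc d) = trans (+-identityˡ _) (sumTo-cut (f ∘ suc) 0 d)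
  sumTo-cut f (suc j) d       = +-congˡ (sumTo-cut (f ∘ suc) j d)

  module _ (n : ℕ) where
    W : ℕ → (List ℕ → Carrier) → Carrier
    W k f = sum f (words n k)

    sum-letters : ∀ f → sum f (letters n) ≈ sumTo (f ∘ suc) (n ∸ 1)
    sum-letters f = reflexive (≡.cong sumL (≡.trans (≡.cong (map f) (map-applyUpTo id suc (n ∸ 1)))
      (map-applyUpTo suc f (n ∸ 1))))

    W-suc : ∀ k f → W (suc k) f ≈ sum (λ a → W k (f ∘ (a ∷_))) (letters n)
    W-suc k f = trans (sum-concatMap f _ (letters n))
      (sum-cong (λ a → reflexive (≡.cong sumL (≡.sym (map-∘ (words n k))))) (letters n))

    -- The length is made available because the weight gained by an appended letter depends on its
    -- position.
    W-cong : ∀ k {f g} → (∀ w → length w ≡ k → f w ≈ g w) → W k f ≈ W k g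
    W-cong zero    p = +-congʳ (p [] ≡.refl)
    W-cong (suc k) {f} {g} p = begin
      W (suc k) f                                ≈⟨ W-suc k f ⟩
      sum (λ a → W k (f ∘ (a ∷_))) (letters n)
        ≈⟨ sum-cong (λ a → W-cong k (λ w e → p (a ∷ w) (≡.cong suc e))) (letters n) ⟩
      sum (λ a → W k (g ∘ (a ∷_))) (letters n)   ≈⟨ W-suc k g ⟨
      W (suc k) g ∎

    -- `words` grows at the front, whereas descents of a permutation show in the last letter of its
    -- reduced words.
    W-last : ∀ k f → W (suc k) f ≈ W k (λ w → sum (λ a → f (w ∷ʳ a)) (letters n))
    W-last zero    f = begin
      W 1 f                                              ≈⟨ W-suc 0 f ⟩
      sum (λ a → f (a ∷ []) + 0#) (letters n)            ≈⟨ sum-cong (λ a → +-identityʳ _) (letters n) ⟩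
      sum (λ a → f (a ∷ [])) (letters n)                 ≈⟨ +-identityʳ _ ⟨
      sum (λ a → f (a ∷ [])) (letters n) + 0# ∎
    W-last (suc k) f = begin
      W (2 Nat.+ k) f                                    ≈⟨ W-suc (suc k) f ⟩
      sum (λ b → W (suc k) (f ∘ (b ∷_))) (letters n)
        ≈⟨ sum-cong (λ b → W-last k (f ∘ (b ∷_))) (letters n) ⟩
      sum (λ b → W k (λ w → sum (λ a → f (b ∷ w ∷ʳ a)) (letters n))) (letters n)
        ≈⟨ W-suc k _ ⟨
      W (suc k) (λ w → sum (λ a → f (w ∷ʳ a)) (letters n)) ∎

    W-∷ʳ : ∀ k f → W (suc k) f ≈ sumTo (λ i → W k (λ w → f (w ∷ʳ suc i))) (n ∸ 1)
    W-∷ʳ k f = begin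
      W (suc k) f                                               ≈⟨ W-last k f ⟩
      W k (λ w → sum (λ a → f (w ∷ʳ a)) (letters n))            ≈⟨ sum-swap _ (words n k) (letters n) ⟩
      sum (λ a → W k (λ w → f (w ∷ʳ a))) (letters n)            ≈⟨ sum-letters _ ⟩
      sumTo (λ i → W k (λ w → f (w ∷ʳ suc i))) (n ∸ 1) ∎

    sumTo-0 : ∀ {f} d → (∀ i → i < d → f i ≈ 0#) → sumTo f d ≈ 0#
    sumTo-0 zero    p = refl
    sumTo-0 (suc d) p = trans (+-cong (p 0 (s≤s z≤n)) (sumTo-0 d (λ i i<d → p (suc i) (s≤s i<d)))) (+-identityʳ 0#)

    restrict : List ℕ → (List ℕ → Carrier) → List ℕ → Carrier
    restrict L f w = if representsᵇ n L w then f w else 0#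

    restrict-∷ʳ : ∀ L f w j → suc j < n →
      restrict L f (w ∷ʳ suc j) ≡ restrict (swapAt (suc j) L) (λ w → f (w ∷ʳ suc j)) w
    restrict-∷ʳ L f w j p = ≡.cong (λ b → if b then f (w ∷ʳ suc j) else 0#) (represents-∷ʳ n L w j p)

    -- Removing the last letter lowers the number of inversions by at most one, and the empty word
    -- represents only the identity.
    too-short : ∀ k L f → k < inversions L → W k (restrict L f) ≈ 0#
    too-short zero L f p = trans (+-identityʳ _) (reflexive empty)
      where
      empty : restrict L f [] ≡ 0#
      empty rewrite represents-[] n L with eqListᵇ (range 1 n) L in e
      ... | false = ≡.refl
      ... | true with eqListᵇ⇒≡ (range 1 n) L e
      ... | ≡.refl = ⊥-elim (Natₚ.n≮0 (≡.subst (0 <_) (inversions-range 1 n) p))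
    too-short (suc k) L f p = trans (W-∷ʳ k (restrict L f)) (sumTo-0 (n ∸ 1) (λ i i<N → trans
      (W-cong k (λ w _ → reflexive (restrict-∷ʳ L f w i (letter-< n i<N))))
      (too-short k (swapAt (suc i) L) _ (Nat.s≤s⁻¹ (≤-trans p (inversions-swapAt-≥ i L))))))

-- Recursions for q-integers and q-factorials

module QNumbers {a ℓ} (R : CommutativeRing a ℓ) (q : CommutativeRing.Carrier R) where
  open CommutativeRing R
  open RingOps R
  open Sums R
  open WordSums R
  open SemiringSolver commutativeSemiring using (solve; _:+_; _:*_; _:=_; con)

  qInt-suc : ∀ k → qInt q (suc k) ≈ 1# + q * qInt q k
  qInt-suc k = +-congˡ (trans (reflexive (≡.cong sumL (map-applyUpTo suc (pow q) k)))
    (trans (sumTo-* q (pow q) k) (*-congˡ (reflexive (≡.cong sumL (≡.sym (map-applyUpTo id (pow q) k)))))))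

  pow-qInt : ∀ {p} → 1# + p ≈ q → ∀ k → 1# + p * qInt q k ≈ pow q k
  pow-qInt {p} e zero    = trans (+-congˡ (zeroʳ p)) (+-identityʳ 1#)
  pow-qInt {p} e (suc k) = begin
    1# + p * qInt q (suc k)           ≈⟨ +-congˡ (*-congˡ (qInt-suc k)) ⟩
    1# + p * (1# + q * qInt q k)      ≈⟨ solve 3 (λ p q i → con 1 :+ p :* (con 1 :+ q :* i)
                                           := (con 1 :+ p) :+ q :* (p :* i)) refl p q (qInt q k) ⟩
    1# + p + q * (p * qInt q k)       ≈⟨ +-congʳ e ⟩
    q + q * (p * qInt q k)            ≈⟨ solve 2 (λ q x → q :+ q :* x := q :* (con 1 :+ x)) refl q (p * qInt q k) ⟩
    q * (1# + p * qInt q k)           ≈⟨ *-congˡ (pow-qInt e k) ⟩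
    q * pow q k ∎
    where open SetoidReasoning setoid

  qFact-suc : ∀ k → qFact q (suc k) ≈ qFact q k * qInt q (suc k)
  qFact-suc k = trans (reflexive (≡.cong prodL (map-applyUpTo id f (suc k))))
    (trans (go f k) (*-congʳ (reflexive (≡.cong prodL (≡.sym (map-applyUpTo id f k))))))
    where
    f = λ i → qInt q (suc i)
    go : ∀ f k → prodL (applyUpTo f (suc k)) ≈ prodL (applyUpTo f k) * f k
    go f zero    = *-comm _ _
    go f (suc k) = trans (*-congˡ (go (f ∘ suc) k)) (sym (*-assoc _ _ _))

-- Reduced words sorted by their last letter

module ReducedWords {a ℓ} (R : CommutativeRing a ℓ) (q : CommutativeRing.Carrier R)
  (u : ℕ → CommutativeRing.Carrier R) (n : ℕ) where
  open CommutativeRing R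
  open RingOps R
  open Sums R
  open WordSums R
  open QNumbers R q
  open SemiringSolver commutativeSemiring using (solve; _:+_; _:*_; _:=_; con)
  open SetoidReasoning setoid

  weight : List ℕ → Carrier
  weight w = pow q (comaj w) * prodL (map u w)

  G : ℕ → List ℕ → Carrier
  G k L = W n k (restrict n L weight)

  -- Words of length k + 1 with last letter a.
  G-last : ℕ → ℕ → List ℕ → Carrier
  G-last k a L = W n k (λ w → restrict n L weight (w ∷ʳ a))

  -- Words of length k + 1 with last letter at most j.
  G-≤ : ℕ → ℕ → List ℕ → Carrier
  G-≤ k j L = sumTo (λ i → G-last k (suc i) L) j

  prodL-∷ʳ : ∀ w a → prodL (map u (w ∷ʳ a)) ≈ u a * prodL (map u w)
  prodL-∷ʳ []      a = refl
  prodL-∷ʳ (b ∷ w) a = trans (*-congˡ (prodL-∷ʳ w a))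
    (solve 3 (λ b a w → b :* (a :* w) := a :* (b :* w)) refl (u b) (u a) (prodL (map u w)))

  weight-∷ʳ : ∀ w b a → weight (w ∷ʳ b ∷ʳ a)
            ≈ u a * (pow q (if b <ᵇ a then suc (length w) else 0) * weight (w ∷ʳ b))
  weight-∷ʳ w b a = begin
    pow q (comaj (w ∷ʳ b ∷ʳ a)) * prodL (map u (w ∷ʳ b ∷ʳ a))
      ≈⟨ *-cong (trans (reflexive (≡.cong (pow q) (comajFrom-∷ʳ 1 w b a))) (pow-+ q (comaj (w ∷ʳ b)) e))
           (prodL-∷ʳ (w ∷ʳ b) a) ⟩
    pow q (comaj (w ∷ʳ b)) * pow q e * (u a * prodL (map u (w ∷ʳ b)))
      ≈⟨ solve 4 (λ c e a w → c :* e :* (a :* w) := a :* (e :* (c :* w))) refl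
           (pow q (comaj (w ∷ʳ b))) (pow q e) (u a) (prodL (map u (w ∷ʳ b))) ⟩
    u a * (pow q e * weight (w ∷ʳ b)) ∎
    where e = if b <ᵇ a then suc (length w) else 0

  G-last-nondescent : ∀ k j L → desc j L ≡ false → inversions L ≡ suc k → j < n ∸ 1 →
                      G-last k (suc j) L ≈ 0#
  G-last-nondescent k j L d e j<N = trans
    (W-cong n k (λ w _ → reflexive (restrict-∷ʳ n L weight w j (letter-< n j<N))))
    (too-short n k (swapAt (suc j) L) _
      (≤-trans (≤-reflexive (≡.sym e)) (inversions-nondescent j L d)))

  G-last-zero : ∀ j L → j < n ∸ 1 → G-last 0 (suc j) L ≈ u (suc j) * G 0 (swapAt (suc j) L)
  G-last-zero j L j<N = begin
    restrict n L weight (suc j ∷ []) + 0#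
      ≈⟨ +-identityʳ _ ⟩
    restrict n L weight (suc j ∷ [])
      ≡⟨ restrict-∷ʳ n L weight [] j (letter-< n j<N) ⟩
    (if representsᵇ n L′ [] then 1# * (u (suc j) * 1#) else 0#)
      ≈⟨ go (representsᵇ n L′ []) ⟩
    u (suc j) * (restrict n L′ weight [] + 0#) ∎
    where
    L′ = swapAt (suc j) L
    go : ∀ b → (if b then 1# * (u (suc j) * 1#) else 0#) ≈ u (suc j) * ((if b then 1# * 1# else 0#) + 0#)
    go true  = solve 1 (λ u → con 1 :* (u :* con 1) := u :* (con 1 :* con 1 :+ con 0)) refl (u (suc j))
    go false = sym (trans (*-congˡ (+-identityʳ 0#)) (zeroʳ _))

  -- Appending j + 1 contributes q^(k+1) if the previous letter is at most j, and 1 otherwise.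
  -- Writing q^(k+1) as 1 + p [k+1] separates the full sum from a correction supported on previous
  -- letters at most j.
  G-last-suc : ∀ {p} → 1# + p ≈ q → ∀ k j d L → j Nat.+ suc d ≡ n ∸ 1 →
    G-last (suc k) (suc j) L ≈ u (suc j) *
      (G (suc k) (swapAt (suc j) L) + p * qInt q (suc k) * G-≤ k j (swapAt (suc j) L))
  G-last-suc {p} e k j d L j+d = begin
    W n (suc k) (λ w → restrict n L weight (w ∷ʳ suc j))
      ≈⟨ W-∷ʳ n k _ ⟩
    sumTo (λ i → W n k (λ w → restrict n L weight (w ∷ʳ suc i ∷ʳ suc j))) (n ∸ 1)
      ≈⟨ sumTo-cong (n ∸ 1) (λ i → trans (W-cong n k (λ w → last-two w i)) (sum-* _ _ (words n k))) ⟩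
    sumTo (λ i → u (suc j) * pow q (c i) * G-last k (suc i) L′) (n ∸ 1)
      ≈⟨ sumTo-cong (n ∸ 1) (λ i → trans (*-assoc _ _ _) (*-congˡ (split i))) ⟩
    sumTo (λ i → u (suc j) * (G-last k (suc i) L′ + cut i)) (n ∸ 1)
      ≈⟨ sumTo-* _ _ (n ∸ 1) ⟩
    u (suc j) * sumTo (λ i → G-last k (suc i) L′ + cut i) (n ∸ 1)
      ≈⟨ *-congˡ (sumTo-+ _ cut (n ∸ 1)) ⟩
    u (suc j) * (G-≤ k (n ∸ 1) L′ + sumTo cut (n ∸ 1))
      ≈⟨ *-congˡ (+-cong (sym (W-∷ʳ n k _)) (trans
           (reflexive (≡.cong (sumTo cut) (≡.sym j+d))) (trans (sumTo-cut _ j (suc d)) (sumTo-* _ _ j)))) ⟩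
    u (suc j) * (G (suc k) L′ + p * qInt q (suc k) * G-≤ k j L′) ∎
    where
    L′ = swapAt (suc j) L
    c : ℕ → ℕ
    c i = if i <ᵇ j then suc k else 0
    cut : ℕ → Carrier
    cut i = if i <ᵇ j then p * qInt q (suc k) * G-last k (suc i) L′ else 0#
    j<N : j < n ∸ 1
    j<N = ≡.subst (j <_) j+d (Natₚ.m<m+n j (s≤s z≤n))
    split : ∀ i → pow q (c i) * G-last k (suc i) L′ ≈ G-last k (suc i) L′ + cut i
    split i with i <ᵇ j
    ... | true  = trans (*-congʳ (sym (pow-qInt e (suc k)))) (trans (distribʳ _ _ _) (+-congʳ (*-identityˡ _)))
    ... | false = trans (*-identityˡ _) (sym (+-identityʳ _))
    last-two : ∀ w i → length w ≡ k → restrict n L weight (w ∷ʳ suc i ∷ʳ suc j)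
             ≈ u (suc j) * pow q (c i) * restrict n L′ weight (w ∷ʳ suc i)
    last-two w i ≡.refl = trans
      (reflexive (restrict-∷ʳ n L weight (w ∷ʳ suc i) j (letter-< n j<N)))
      (go (representsᵇ n L′ (w ∷ʳ suc i)))
      where
      go : ∀ b → (if b then weight (w ∷ʳ suc i ∷ʳ suc j) else 0#)
               ≈ u (suc j) * pow q (c i) * (if b then weight (w ∷ʳ suc i) else 0#)
      go true  = trans (weight-∷ʳ w (suc i) (suc j)) (sym (*-assoc _ _ _))
      go false = sym (zeroʳ _)

-- The factorisation in 𝒦₊ and the induction on length

module Identity {a ℓ} (R : CommutativeRing a ℓ) (q : CommutativeRing.Carrier R)
  (u : ℕ → CommutativeRing.Carrier R) (n : ℕ) where
  open CommutativeRing R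
  open RingOps R
  open RingProperties ring using (-0#≈0#; -‿distribˡ-*)
  open QNumbers R q
  open ReducedWords R q u n
  open Operators R using (S)
  open OperatorValues R using (ind)
  open SemiringSolver commutativeSemiring using (solve; _:+_; _:*_; _:=_; con)

  p : Carrier
  p = q - 1#

  1+p : 1# + p ≈ q
  1+p = trans (+-comm _ _) (trans (+-assoc _ _ _) (trans (+-congˡ (-‿inverseˡ 1#)) (+-identityʳ q)))

  open Embedding R p
  private
    module OE = Operators extension
    module VE = OperatorValues extension
    module RE = RingOps extension

  N : ℕ
  N = n ∸ 1

  x : ℕ → Carrier
  x k = u (suc k) - u k

  𝔖 : List ℕ → Carrier
  𝔖 = S N x (ind 1 n)

  1+s : E.Carrier
  1+s = 1# , 1#

  -- At s = q - 1 these are q x and (1 - q) u. For all s, `z k + g k` is x_k - s u_k, that is x_k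
  -- plus the previous g, which is the telescoping that `S-factor` asks for.
  z g : ℕ → E.Carrier
  z k = 1+s E.* embed (x k)
  g k = 0# , - u (suc k)

  -- 𝔖((1 + s) x) (1 - s u_N e_N) ⋯ (1 - s u_{j+1} e_{j+1}); it is 𝔖(x) for j = 0, and 𝔖((1 + s) x)
  -- for j = N.  Here s² = (q - 1) s, hence (1 + s)ˡ = 1 + [l] s and s (1 + s) = q s.
  P : ℕ → ℕ → List ℕ → E.Carrier
  P j d = OE.H g j d (OE.S N z (VE.ind 1 n))

  scale-embed : ∀ b c → (1# , c) E.* embed b E.≈ (b , c * b)
  scale-embed b c = *-identityˡ b , solve 3 (λ p b c →
    con 1 :* con 0 :+ c :* b :+ p :* (c :* con 0) := c :* b) refl p b c

  pow-1+s : ∀ k → RE.pow 1+s k E.≈ (1# , qInt q k)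
  pow-1+s zero    = refl , refl
  pow-1+s (suc k) = E.trans (E.*-congˡ {x = 1+s} (pow-1+s k)) (*-identityˡ 1# , trans
    (solve 2 (λ p i → con 1 :* i :+ con 1 :* con 1 :+ p :* (con 1 :* i)
       := con 1 :+ (con 1 :+ p) :* i) refl p (qInt q k))
    (trans (+-congˡ (*-congʳ 1+p)) (sym (qInt-suc k))))

  -- By homogeneity, scaling the variables by 1 + s multiplies the coefficient at `L` by (1 + s)^l
  -- with l = `inversions L`; this is where the q-integer comes from.
  P-end : ∀ L → OE.S N z (VE.ind 1 n) L E.≈ (𝔖 L , qInt q (inversions L) * 𝔖 L)
  P-end L = E.trans (OE.Linear.cong (OE.S-linear N z) ind-twist L) (E.trans
    (NE.natural-S N (λ k → E.refl) inversions inversions-descent (ind 1 n) L)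
    (E.trans (E.*-congʳ {x = embed (𝔖 L)} (pow-1+s (inversions L))) (scale-embed _ _)))
    where
    module NE = Naturality R extension embed embed-isHom 1+s
    ind-twist : ∀ L → VE.ind 1 n L E.≈ NE.twist inversions (ind 1 n) L
    ind-twist L = go (eqListᵇ (range 1 n) L) ≡.refl
      where
      go : ∀ b → eqListᵇ (range 1 n) L ≡ b → (if b then E.1# else E.0#)
         E.≈ RE.pow 1+s (inversions L) E.* embed (if b then 1# else 0#)
      go false _ = E.sym (E.zeroʳ (RE.pow 1+s (inversions L)))
      go true  e = E.trans (E.sym (E.*-identityˡ E.1#))
        (E.reflexive (≡.cong (λ k → RE.pow 1+s k E.* E.1#) (≡.sym inversions≡0)))
        where
        inversions≡0 : inversions L ≡ 0
        inversions≡0 = ≡.trans (≡.cong inversions (≡.sym (eqListᵇ⇒≡ (range 1 n) L e))) (inversions-range 1 n)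

  module _ (u₀≈0 : u 0 ≈ 0#)
    (relation : ∀ k → (q + 1#) * (u (suc k) * u (suc k))
                    ≈ q * (u (suc k) * u k) + u (suc k) * u (suc (suc k))) where
    open SetoidReasoning setoid

    q*x : ∀ k → u (suc k) * (q * x k) ≈ u (suc k) * x (suc k)
    q*x k = begin
      b * (q * (b + - a′))           ≈⟨ solve 3 (λ q b m → b :* (q :* (b :+ m)) := q :* (b :* b) :+ q :* (b :* m))
                                         refl q b (- a′) ⟩
      q * (b * b) + q * (b * - a′)   ≈⟨ +-congʳ move ⟩
      q * (b * a′) + (b * c + b * - b) + q * (b * - a′)
        ≈⟨ solve 5 (λ q b a c m → q :* (b :* a) :+ c :+ q :* (b :* m) := c :+ q :* (b :* (a :+ m)))
             refl q b a′ (b * c + b * - b) (- a′) ⟩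
      b * c + b * - b + q * (b * (a′ - a′))
        ≈⟨ +-congˡ (trans (*-congˡ (trans (*-congˡ (-‿inverseʳ a′)) (zeroʳ b))) (zeroʳ q)) ⟩
      b * c + b * - b + 0#           ≈⟨ trans (+-identityʳ _) (sym (distribˡ _ _ _)) ⟩
      b * (c - b) ∎
      where
      a′ = u k
      b  = u (suc k)
      c  = u (suc (suc k))
      move : q * (b * b) ≈ q * (b * a′) + (b * c + b * - b)
      move = begin
        q * (b * b)                                ≈⟨ +-identityʳ _ ⟨
        q * (b * b) + 0#                           ≈⟨ +-congˡ (trans (*-congˡ (-‿inverseʳ b)) (zeroʳ b)) ⟨
        q * (b * b) + b * (b - b)                  ≈⟨ solve 3 (λ q b m → q :* (b :* b) :+ b :* (b :+ m)
                                                        := (q :+ con 1) :* (b :* b) :+ b :* m) refl q b (- b) ⟩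
        (q + 1#) * (b * b) + b * - b               ≈⟨ +-congʳ (relation k) ⟩
        q * (b * a′) + b * c + b * - b             ≈⟨ +-assoc _ _ _ ⟩
        q * (b * a′) + (b * c + b * - b) ∎

    g-* : ∀ k y → g k E.* y E.≈ (0# , - (u (suc k) * (proj₁ y + p * proj₂ y)))
    g-* k (b , d) = zeroˡ b , trans
      (solve 4 (λ p e b d → con 0 :* d :+ e :* b :+ p :* (e :* d) := e :* (b :+ p :* d)) refl p (- u (suc k)) b d)
      (sym (-‿distribˡ-* _ _))

    z≈ : ∀ k → z k E.≈ (x k , x k)
    z≈ k = E.trans (scale-embed (x k) 1#) (refl , *-identityˡ _)

    -- With all factors present the product lies in the base ring, so its s-component vanishes: the
    -- initial value for the sums over last letters.
    P-start : ∀ m → N ≡ m → ∀ L → OE.H g 0 m (OE.S m z (VE.ind 1 n)) L E.≈ embed (S m x (ind 1 n) L)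
    P-start zero    _ L = ind-natural R extension embed embed-isHom 1 n L
    P-start (suc m) _ L = E.trans
      (E.sym (OE.S-factor {x = embed ∘ x} {z = z} {g = g} m (embed (x 0)) first step exchange (VE.ind 1 n) L))
      (S-natural R extension embed embed-isHom (suc m) {v = x} (λ k → E.refl)
        (ind-natural R extension embed embed-isHom 1 n) L)
      where
      -- Here z_0 + g_0 = x_0 - s u_0, so u_0 = 0 starts the telescoping.
      first : embed (x 0) E.≈ z 0 E.+ g 0
      first = E.sym (E.trans (E.+-congʳ {x = g 0} (z≈ 0)) (+-identityʳ _ , (begin
        u 1 - u 0 - u 1          ≈⟨ +-congʳ (+-congˡ (trans (-‿cong u₀≈0) -0#≈0#)) ⟩
        u 1 + 0# - u 1           ≈⟨ +-congʳ (+-identityʳ _) ⟩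
        u 1 - u 1                ≈⟨ -‿inverseʳ _ ⟩
        0# ∎)))
      step : ∀ k → embed (x (suc k)) E.+ g k E.≈ z (suc k) E.+ g (suc k)
      step k = E.sym (E.trans (E.+-congʳ {x = g (suc k)} (z≈ (suc k))) (refl , (begin
        c - b - c            ≈⟨ solve 3 (λ c b m → c :+ b :+ m := c :+ m :+ b) refl c (- b) (- c) ⟩
        c - c - b            ≈⟨ +-congʳ (-‿inverseʳ c) ⟩
        0# - b ∎)))
        where
        b = u (suc k)
        c = u (suc (suc k))
      -- `g k` is a multiple of s, so only the values at s = q - 1 are compared; there the claim is
      -- `q*x`.
      exchange : ∀ k → g k E.* z k E.≈ g k E.* embed (x (suc k))
      exchange k = E.trans (E.*-congˡ {x = g k} (z≈ k)) (E.trans (g-* k (x k , x k)) (E.trans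
        (refl , -‿cong (begin
          u (suc k) * (x k + p * x k)
            ≈⟨ *-congˡ (solve 2 (λ p x → x :+ p :* x := (con 1 :+ p) :* x) refl p (x k)) ⟩
          u (suc k) * ((1# + p) * x k)         ≈⟨ *-congˡ (*-congʳ 1+p) ⟩
          u (suc k) * (q * x k)                ≈⟨ q*x k ⟩
          u (suc k) * x (suc k)                ≈⟨ *-congˡ (trans (+-congˡ (zeroʳ p)) (+-identityʳ _)) ⟨
          u (suc k) * (x (suc k) + p * 0#) ∎))
        (E.sym (g-* k (embed (x (suc k)))))))

    P-nondescent : ∀ j d L → desc j L ≡ false → P j (suc d) L E.≈ P (suc j) d L
    P-nondescent j d L e = VE.h-nondescent j L e

    P-descent : ∀ j d L → desc j L ≡ true → P j (suc d) L E.≈ P (suc j) d L E.+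
      (0# , - (u (suc j) * (proj₁ (P (suc j) d (swapAt (suc j) L)) + p * proj₂ (P (suc j) d (swapAt (suc j) L)))))
    P-descent j d L e = E.trans (VE.h-descent j L e)
      (E.+-congˡ {x = P (suc j) d L} (g-* j (P (suc j) d (swapAt (suc j) L))))

    proj₁-step : ∀ j d L → proj₁ (P j (suc d) L) ≈ proj₁ (P (suc j) d L)
    proj₁-step j d L = go (desc j L) ≡.refl
      where
      go : ∀ b → desc j L ≡ b → proj₁ (P j (suc d) L) ≈ proj₁ (P (suc j) d L)
      go true  e = trans (proj₁ (P-descent j d L e)) (+-identityʳ _)
      go false e = proj₁ (P-nondescent j d L e)

    -- Each factor is 1 modulo s, so the value at s = 0 is the same for all partial products.
    P₁ : ∀ j d → j Nat.+ d ≡ N → ∀ L → proj₁ (P j d L) ≈ 𝔖 L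
    P₁ zero    d ≡.refl L = proj₁ (P-start N ≡.refl L)
    P₁ (suc j) d e L = trans (sym (proj₁-step j d L)) (P₁ j (suc d) (≡.trans (Natₚ.+-suc j d) e) L)

    c : ℕ → ℕ → List ℕ → Carrier
    c j d L = proj₂ (P j d L)

    -- Since L′ has no descent at j, its s-component may be taken at j instead of j + 1. This
    -- matches the previous letters at most j in `G-last-suc`.
    c-descent : ∀ j d → j Nat.+ suc d ≡ N → ∀ L → desc j L ≡ true →
      let L′ = swapAt (suc j) L in
      c (suc j) d L ≈ c j (suc d) L + u (suc j) * (𝔖 L′ + p * c j (suc d) L′)
    c-descent j d e L ds = begin
      c (suc j) d L                            ≈⟨ +-identityʳ _ ⟨
      c (suc j) d L + 0#                       ≈⟨ +-congˡ (-‿inverseˡ y) ⟨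
      c (suc j) d L + (- y + y)                ≈⟨ +-assoc _ _ _ ⟨
      c (suc j) d L + - y + y                  ≈⟨ +-congʳ (proj₂ (P-descent j d L ds)) ⟨
      c j (suc d) L + y
        ≈⟨ +-congˡ (*-congˡ (+-cong (P₁ (suc j) d (≡.trans (≡.sym (Natₚ.+-suc j d)) e) L′)
             (*-congˡ (sym (proj₂ (P-nondescent j d L′ (desc-swapAt j L ds))))))) ⟩
      c j (suc d) L + u (suc j) * (𝔖 L′ + p * c j (suc d) L′) ∎
      where
      L′ = swapAt (suc j) L
      y = u (suc j) * (proj₁ (P (suc j) d L′) + p * proj₂ (P (suc j) d L′))

    c-end : ∀ L → c N 0 L ≈ qInt q (inversions L) * 𝔖 L
    c-end L = proj₂ (P-end L)

    -- Reduced words ending in j + 1, in terms of the s-component c of P.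
    LastDescent : ℕ → Set ℓ
    LastDescent k = ∀ j d → j Nat.+ suc d ≡ N → ∀ L → desc j L ≡ true → inversions L ≡ suc k →
      let L′ = swapAt (suc j) L in
      G-last k (suc j) L ≈ u (suc j) * (qFact q k * (𝔖 L′ + p * c j (suc d) L′))

    -- Both sides vanish at j = 0 and have equal increments: `c-descent` at a descent, zero
    -- otherwise. `LastDescent k` is an argument because its proof in the next length relies on this
    -- lemma.
    G-≤-c : ∀ k → LastDescent k → ∀ j d → j Nat.+ d ≡ N → ∀ L → inversions L ≡ suc k →
            G-≤ k j L ≈ qFact q k * c j d L
    G-≤-c k last zero d e L i = sym (trans (*-congˡ (trans
      (reflexive (≡.cong (λ d → c 0 d L) e)) (proj₂ (P-start N ≡.refl L)))) (zeroʳ _))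
    G-≤-c k last (suc j) d e L i = trans (WordSums.sumTo-suc R _ j)
      (trans (+-congʳ (G-≤-c k last j (suc d) e′ L i)) (go (desc j L) ≡.refl))
      where
      e′ : j Nat.+ suc d ≡ N
      e′ = ≡.trans (Natₚ.+-suc j d) e
      j<N : j < N
      j<N = ≡.subst (j <_) e′ (Natₚ.m<m+n j (s≤s z≤n))
      L′ = swapAt (suc j) L
      go : ∀ b → desc j L ≡ b → qFact q k * c j (suc d) L + G-last k (suc j) L ≈ qFact q k * c (suc j) d L
      go false ds = trans (+-congˡ (G-last-nondescent k j L ds i j<N))
        (trans (+-identityʳ _) (*-congˡ (proj₂ (P-nondescent j d L ds))))
      go true  ds = begin
        qFact q k * c j (suc d) L + G-last k (suc j) L
          ≈⟨ +-congˡ (last j d e′ L ds i) ⟩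
        qFact q k * c j (suc d) L + u (suc j) * (qFact q k * (𝔖 L′ + p * c j (suc d) L′))
          ≈⟨ solve 4 (λ f c u y → f :* c :+ u :* (f :* y) := f :* (c :+ u :* y)) refl
               (qFact q k) (c j (suc d) L) (u (suc j)) (𝔖 L′ + p * c j (suc d) L′) ⟩
        qFact q k * (c j (suc d) L + u (suc j) * (𝔖 L′ + p * c j (suc d) L′))
          ≈⟨ *-congˡ (c-descent j d e′ L ds) ⟨
        qFact q k * c (suc j) d L ∎

    G-suc : ∀ k → LastDescent k → ∀ L → inversions L ≡ suc k → G (suc k) L ≈ qFact q (suc k) * 𝔖 L
    G-suc k last L i = begin
      G (suc k) L                              ≈⟨ WordSums.W-∷ʳ R n k _ ⟩
      G-≤ k N L                                ≈⟨ G-≤-c k last N 0 (Natₚ.+-identityʳ N) L i ⟩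
      qFact q k * c N 0 L                      ≈⟨ *-congˡ (c-end L) ⟩
      qFact q k * (qInt q (inversions L) * 𝔖 L)
        ≡⟨ ≡.cong (λ l → qFact q k * (qInt q l * 𝔖 L)) i ⟩
      qFact q k * (qInt q (suc k) * 𝔖 L)       ≈⟨ *-assoc _ _ _ ⟨
      qFact q k * qInt q (suc k) * 𝔖 L         ≈⟨ *-congʳ (qFact-suc k) ⟨
      qFact q (suc k) * 𝔖 L ∎

    G-zero : ∀ L → inversions L ≡ 0 → G 0 L ≈ 𝔖 L
    G-zero L i = begin
      restrict-[] + 0#          ≈⟨ +-identityʳ _ ⟩
      restrict-[]               ≡⟨ ≡.cong (λ b → if b then 1# * 1# else 0#) (represents-[] n L) ⟩
      (if eqListᵇ (range 1 n) L then 1# * 1# else 0#)   ≈⟨ go (eqListᵇ (range 1 n) L) ⟩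
      ind 1 n L                 ≈⟨ OperatorValues.S-0 R N x (ind 1 n) L i ⟨
      𝔖 L ∎
      where
      restrict-[] = if representsᵇ n L [] then 1# * 1# else 0#
      go : ∀ b → (if b then 1# * 1# else 0#) ≈ (if b then 1# else 0#)
      go true  = *-identityˡ 1#
      go false = refl

    c-zero : ∀ j d L → inversions L ≡ 0 → c j d L ≈ 0#
    c-zero j d L i = trans (proj₂ (VE.H-0 g j d _ L i)) (trans (c-end L)
      (trans (*-congʳ (reflexive (≡.cong (qInt q) i))) (zeroˡ _)))

    inversions-pred : ∀ j L {k} → desc j L ≡ true → inversions L ≡ suc k → inversions (swapAt (suc j) L) ≡ k
    inversions-pred j L ds i = Natₚ.suc-injective (≡.trans (≡.sym (inversions-descent j L ds)) i)

    -- In `G-last-suc` the full sum yields [k+1]! 𝔖, while the truncated sum yields only [k]! c but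
    -- comes with the factor [k+1]; hence [k+1]! is common to both.
    last-descent : ∀ k → LastDescent k
    last-descent zero j d e L ds i = begin
      G-last 0 (suc j) L                                 ≈⟨ G-last-zero j L j<N ⟩
      u (suc j) * G 0 L′                                 ≈⟨ *-congˡ (G-zero L′ i′) ⟩
      u (suc j) * 𝔖 L′                                   ≈⟨ *-congˡ (trans (*-identityˡ _) (trans (+-congˡ
        (trans (*-congˡ (c-zero j (suc d) L′ i′)) (zeroʳ p))) (+-identityʳ _))) ⟨
      u (suc j) * (1# * (𝔖 L′ + p * c j (suc d) L′)) ∎
      where
      L′ = swapAt (suc j) L
      i′ = inversions-pred j L ds i
      j<N : j < N
      j<N = ≡.subst (j <_) e (Natₚ.m<m+n j (s≤s z≤n))
    last-descent (suc k) j d e L ds i = begin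
      G-last (suc k) (suc j) L
        ≈⟨ G-last-suc 1+p k j d L e ⟩
      u (suc j) * (G (suc k) L′ + p * qInt q (suc k) * G-≤ k j L′)
        ≈⟨ *-congˡ (+-cong (trans (G-suc k (last-descent k) L′ i′) (*-congʳ (qFact-suc k)))
             (*-congˡ (G-≤-c k (last-descent k) j (suc d) e L′ i′))) ⟩
      u (suc j) * (qFact q k * qInt q (suc k) * 𝔖 L′ + p * qInt q (suc k) * (qFact q k * c j (suc d) L′))
        ≈⟨ *-congˡ (solve 5 (λ f t s p c → f :* t :* s :+ p :* t :* (f :* c) := f :* t :* (s :+ p :* c)) refl
             (qFact q k) (qInt q (suc k)) (𝔖 L′) p (c j (suc d) L′)) ⟩
      u (suc j) * (qFact q k * qInt q (suc k) * (𝔖 L′ + p * c j (suc d) L′))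
        ≈⟨ *-congˡ (*-congʳ (qFact-suc k)) ⟨
      u (suc j) * (qFact q (suc k) * (𝔖 L′ + p * c j (suc d) L′)) ∎
      where
      L′ = swapAt (suc j) L
      i′ = inversions-pred j L ds i

    G-𝔖 : ∀ k L → inversions L ≡ k → G k L ≈ qFact q k * 𝔖 L
    G-𝔖 zero    L i = trans (G-zero L i) (sym (*-identityˡ _))
    G-𝔖 (suc k) L i = G-suc k (last-descent k) L i

-- Passage to permutations and to the ground field

oneLine-arrangement : ∀ {n} (w : Permutation′ n) → Arrangement n (oneLine w)
oneLine-arrangement {n} w = record
  { size   = ≡.trans (length-map _ (allFin n)) (length-tabulate id)
  ; bounds = Allₚ.map⁺ (All.universal (λ i → s≤s z≤n , toℕ<n (w ⟨$⟩ʳ i)) (allFin n))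
  ; unique = Uniqueₚ.map⁺ (λ e → injective (toℕ-injective (Natₚ.suc-injective e))) (Uniqueₚ.allFin⁺ n)
  }
  where
  injective : ∀ {i j} → w ⟨$⟩ʳ i ≡ w ⟨$⟩ʳ j → i ≡ j
  injective e = ≡.trans (≡.sym (inverseˡ w)) (≡.trans (≡.cong (w ⟨$⟩ˡ_) e) (inverseˡ w))

evalPoly-schubert : ∀ {a ℓ} (R : CommutativeRing a ℓ) v n (w : Permutation′ n) →
  CommutativeRing._≈_ R (evalPoly R v (schubert n w))
    (Operators.S R (n ∸ 1) (v ∘ suc) (OperatorValues.ind R 1 n) (oneLine w))
evalPoly-schubert R v zero w =
  trans (+-identityʳ _) (trans (*-identityʳ _) (+-identityʳ 1#))
  where open CommutativeRing R
evalPoly-schubert R v (suc m) w = evalPoly-schubertAux R m (suc m Nat.* suc m) (oneLine w) v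
  (oneLine-arrangement w) (Natₚ.m≤n+m _ (inversions (oneLine w)))

module QNumbersInField {c ℓ} (K : Field c ℓ) (char0 : CharacteristicZero K)
  (q : Field.Carrier K) (q-generic : NotNontrivialRootOfUnity K q) where
  open Field K
  open RingOps commutativeRing
  open QNumbers commutativeRing q
  open SetoidReasoning setoid

  *-nonzero : ∀ {x y} → ¬ (x ≈ 0#) → ¬ (y ≈ 0#) → ¬ (x * y ≈ 0#)
  *-nonzero {x} {y} x≉0 y≉0 e = y≉0 (begin
    y                  ≈⟨ *-identityˡ y ⟨
    1# * y             ≈⟨ *-congʳ (trans (*-comm _ _) (⁻¹-inverse x x≉0)) ⟨
    x ⁻¹ * x * y       ≈⟨ *-assoc _ _ _ ⟩
    x ⁻¹ * (x * y)     ≈⟨ *-congˡ e ⟩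
    x ⁻¹ * 0#          ≈⟨ zeroʳ _ ⟩
    0# ∎)

  qInt-1 : q ≈ 1# → ∀ k → qInt q k ≈ natCast k
  qInt-1 e zero    = refl
  qInt-1 e (suc k) = trans (qInt-suc k) (+-congˡ (trans (*-cong e (qInt-1 e k)) (*-identityˡ _)))

  -- If [k+1] = 0 then q^(k+1) = 1, so q = 1 by genericity; but then [k+1] is the integer k + 1,
  -- nonzero in characteristic zero.
  qInt-nonzero : ∀ k → ¬ (qInt q (suc k) ≈ 0#)
  qInt-nonzero k e = char0 k (trans (sym (qInt-1 (q-generic k (begin
    pow q (suc k)                        ≈⟨ pow-qInt 1+[q-1] (suc k) ⟨
    1# + (q - 1#) * qInt q (suc k)       ≈⟨ +-congˡ (trans (*-congˡ e) (zeroʳ _)) ⟩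
    1# + 0#                              ≈⟨ +-identityʳ 1# ⟩
    1# ∎)) (suc k))) e)
    where
    1+[q-1] : 1# + (q - 1#) ≈ q
    1+[q-1] = trans (+-comm _ _) (trans (+-assoc _ _ _) (trans (+-congˡ (-‿inverseˡ 1#)) (+-identityʳ q)))

  qFact-nonzero : ∀ k → ¬ (qFact q k ≈ 0#)
  qFact-nonzero zero    e = 0≉1 (sym e)
  qFact-nonzero (suc k) e = *-nonzero (qFact-nonzero k) (qInt-nonzero k) (trans (sym (qFact-suc k)) e)

module AlgebraMap {a ℓ b ℓ′} (R : CommutativeRing a ℓ) (A : CommutativeRing b ℓ′)
  (ι : CommutativeRing.Carrier R → CommutativeRing.Carrier A)
  (ι-isHom : IsRingHomomorphism (CommutativeRing.rawRing R) (CommutativeRing.rawRing A) ι)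
  (q : CommutativeRing.Carrier R) where
  open CommutativeRing A
  open IsRingHomomorphism ι-isHom
  private
    module R = RingOps R
    module A = RingOps A

  ι-pow : ∀ k → ι (R.pow q k) ≈ A.pow (ι q) k
  ι-pow zero    = 1#-homo
  ι-pow (suc k) = trans (*-homo _ _) (*-congˡ (ι-pow k))

  ι-qInt : ∀ k → ι (R.qInt q k) ≈ A.qInt (ι q) k
  ι-qInt zero    = 0#-homo
  ι-qInt (suc k) = trans (⟦⟧-cong (QNumbers.qInt-suc R q k)) (trans (+-homo _ _) (trans
    (+-cong 1#-homo (trans (*-homo _ _) (*-congˡ (ι-qInt k)))) (sym (QNumbers.qInt-suc A (ι q) k))))

  ι-qFact : ∀ k → ι (R.qFact q k) ≈ A.qFact (ι q) k
  ι-qFact zero    = 1#-homo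
  ι-qFact (suc k) = trans (⟦⟧-cong (QNumbers.qFact-suc R q k)) (trans (*-homo _ _) (trans
    (*-cong (ι-qFact k) (ι-qInt (suc k))) (sym (QNumbers.qFact-suc A (ι q) k))))

theorem1p4 : ∀ {c ℓ a ℓ′ : Level} (K : Field c ℓ) → CharacteristicZero K →
    (q : Field.Carrier K) → NotNontrivialRootOfUnity K q →
    (A : CommutativeRing a ℓ′) (ι : Field.Carrier K → CommutativeRing.Carrier A) →
    IsAlgebraMap K A ι →
    (u : ℕ → CommutativeRing.Carrier A) → K₊Relations A (ι q) u →
    (n : ℕ) (w : Permutation′ n) →
    CommutativeRing._≈_ A
    (evalPoly A (xSubst A u) (schubert n w))
    (CommutativeRing._*_ A
    (ι (Field._⁻¹ K (RingOps.qFact (Field.commutativeRing K) q (len w))))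
    (RingOps.sumL A (map (λ word → CommutativeRing._*_ A
    (ι (RingOps.pow (Field.commutativeRing K) q (comaj word)))
    (RingOps.prodL A (map (u₀ A u) word)))
    (Red n w))))
theorem1p4 K char0 q q-generic A ι ι-isHom u relations n w = begin
  evalPoly A (xSubst A u) (schubert n w)
    -- Variables are numbered from 1 in polynomials and from 0 in operators; `xSubst A u (suc k)`
    -- computes to the k-th difference used in `𝔖`.
    ≈⟨ evalPoly-schubert A (xSubst A u) n w ⟩
  𝔖 L
    ≈⟨ *-identityˡ _ ⟨
  1# * 𝔖 L
    ≈⟨ *-congʳ (trans (sym (*-homo _ _)) (trans (⟦⟧-cong (K.trans (K.*-comm _ _)
         (K.⁻¹-inverse f (qFact-nonzero (len w))))) 1#-homo)) ⟨
  ι (f K.⁻¹) * ι f * 𝔖 L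
    ≈⟨ *-assoc _ _ _ ⟩
  ι (f K.⁻¹) * (ι f * 𝔖 L)
    ≈⟨ *-congˡ (*-congʳ (ι-qFact (len w))) ⟩
  ι (f K.⁻¹) * (qFact (ι q) (len w) * 𝔖 L)
    ≈⟨ *-congˡ (G-𝔖 refl relations (len w) L ≡.refl) ⟨
  ι (f K.⁻¹) * G (len w) L
    ≈⟨ *-congˡ (sum-filter weight (representsᵇ n L) (words n (len w))) ⟨
  ι (f K.⁻¹) * sum weight (Red n w)
    ≈⟨ *-congˡ (sum-cong (λ word → *-congʳ (ι-pow (comaj word))) (Red n w)) ⟨
  ι (f K.⁻¹) * sum (λ word → ι (RingOps.pow K.commutativeRing q (comaj word)) * prodL (map (u₀ A u) word)) (Red n w) ∎
  where
  module K = Field K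
  open CommutativeRing A
  open IsRingHomomorphism ι-isHom using (*-homo; ⟦⟧-cong; 1#-homo)
  open RingOps A
  open WordSums A
  open ReducedWords A (ι q) (u₀ A u) n
  open Identity A (ι q) (u₀ A u) n using (𝔖; G-𝔖)
  open AlgebraMap K.commutativeRing A ι ι-isHom q
  open QNumbersInField K char0 q q-generic using (qFact-nonzero)
  open SetoidReasoning setoid
  L = oneLine w
  f = RingOps.qFact K.commutativeRing q (len w)
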